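{- Let $a\in\{1,2\}$ and let $n,m,k$ be integers with $1\le m\le n$, $2\le k\le 2a3^{m-1}+1$ and $k<a3^m$. Then $$v_3\big(s(a3^n,a3^m-k)\big)=\frac{a}{2}(3^n-3^m)-(n-m)(a3^m-k)+m-1-v_3\Big(\Big\lfloor\frac{k}{2}\Big\rfloor\Big)+(m+v_3(k))\epsilon_k .$$
   Context: For integers $N\ge 1$ and $K\ge 0$, $s(N,K)$ denotes the (unsigned) Stirling number of the first kind, i.e. the number of permutations of $N$ elements with exactly $K$ disjoint cycles; equivalently $x(x-1)\cdots(x-N+1)=\sum_{K=0}^N(-1)^{N-K}s(N,K)x^K$. For a nonzero integer $x$, $v_3(x)$ is the largest integer $r\ge0$ with $3^r\mid x$. $\lfloor x\rfloor$ is the floor of $x$. $\epsilon_k=0$ if $k$ is even and $\epsilon_k=1$ if $k$ is odd. -}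

module Defs where

open import Data.Nat using (ℕ; zero; suc; _+_; _*_; _^_; _%_; _/_)
open import Data.Nat.Divisibility using (_∣_; _∣?_)
open import Relation.Nullary using (yes; no)

stirling1 : ℕ → ℕ → ℕ
stirling1 zero    zero    = 1
stirling1 zero    (suc k) = 0
stirling1 (suc n) zero    = 0
stirling1 (suc n) (suc k) = n * stirling1 n (suc k) + stirling1 n k

-- 3-adic valuation, computed with fuel; v3 x = largest r with 3^r ∣ x (for x ≥ 1)
v3-aux : ℕ → ℕ → ℕ
v3-aux zero    x = 0
v3-aux (suc f) x with 3 ∣? x
... | yes _ = suc (v3-aux f (x / 3))
... | no  _ = 0

v3 : ℕ → ℕ
v3 x = v3-aux x x

ε : ℕ → ℕ
ε k = k % 2

-- Write M = a 3^m, T = a 3^(m-1), e = n - m, N = 3^e M and K = M - k.  Dividing out the powers of 3 from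
-- ∏_{i<N} (3^e y + i) leaves an integral polynomial P(y) whose K-th coefficient is 3^(eK) s(N,K) up to a known
-- power of 3.  Tripling M multiplies three translates of P, so cubing lifts a congruence modulo 3 to
-- P(y) ≡ 2^j (y (y² + 2))^T modulo 3^m.  For k = 2t the coefficient is therefore a unit times C(T,t) modulo 3^m, and
-- v₃(C(T,t)) = m - 1 - v₃(t) is small enough to be visible.  For odd k the coefficient vanishes modulo 3^m, and its
-- valuation is found from the symmetry y P(y - M) = ± (y - M) P(-y), which expresses it through the even-index
-- coefficient next to it:  2 P_K = M K P_{K+1} - M² C(K+2,2) P_{K+2} + O(M³).

{-# OPTIONS --safe #-}
module Submission where

open import Defs
open import Data.Nat using (ℕ; _≤_; _<_; _^_; _/_; _∸_)
open import Data.Integer using (ℤ; +_; _+_; _-_; _*_)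
open import Relation.Binary.PropositionalEquality using (_≡_)
open import Data.Sum using (_⊎_)

open import Algebra.Bundles using (CommutativeRing)
open import Algebra.Structures using (IsCommutativeRing)
open import Data.Empty using (⊥-elim)
open import Data.Integer using (-_; 0ℤ; 1ℤ; ∣_∣) renaming (_^_ to _^ᶻ_)
import Data.Integer.Properties as ℤ
open import Data.Integer.Tactic.RingSolver using (solve-∀)
open import Data.Nat using (zero; suc)
import Data.Nat as ℕ
open import Data.Nat.Combinatorics using (_C_; nCk+nC[k+1]≡[n+1]C[k+1]; k>n⇒nCk≡0; nCk≡nC[n∸k])
open import Data.Nat.Divisibility using (_∣_; divides; _∣?_)
open import Data.Nat.DivMod using (m≡m%n+[m/n]*n; m%n<n; m*n/n≡m; m*n%n≡0; [m+kn]%n≡m%n; +-distrib-/-∣ʳ)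
import Data.Nat.Properties as ℕ
import Data.Nat.Tactic.RingSolver as ℕ-Solver
open import Data.Product using (∃; _,_)
open import Data.Sum using (inj₁; inj₂)
open import Level using (0ℓ)
open import Relation.Binary.PropositionalEquality using (refl; sym; trans; cong; cong₂; subst; module ≡-Reasoning)
open import Relation.Nullary using (¬_; yes; no)

-- Tripling gains a factor of 3 because the translates are by 0, M and 2M: their first-order Taylor
-- terms add up to 3M P² P', and every later term contains M².
--
-- The range of k comes from the lowest term y^T of (y (y² + 2))^T: even k is read off for K ≥ T,
-- that is, for k ≤ 2T. The odd case consults only the indices K + 1 and K + 2, which admits one
-- further value, k = 2T + 1.
--
-- Precision is the obstacle for odd k = 2t + 1, where P_K is 0 modulo 3^m. As P_(K+2) also vanishes
-- modulo 3^m, all terms of the recurrence after the first are multiples of 3^(3m). The first has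
-- valuation m + v₃(K) + (m - 1 - v₃(t)), which is below 3m because v₃(K) ≤ m; and v₃(K) = v₃(k)
-- because K + k = a 3^m with a < 3.
--
-- Division is avoided: valuations are determined after multiplication by t, where t C(T,t) = T
-- C(T-1,t-1) is 3^(m-1) times the unit a C(T-1,t-1), and factors 2 and 4 stay in place as units.

-- The ring of formal power series over the integers.

Series : Set
Series = ℕ → ℤ

infix 4 _≋_
-- A record rather than the bare pointwise equation, so that both series can be recovered from the
-- type.
record _≋_ (f g : Series) : Set where
  constructor coeffwise
  field coeff : ∀ n → f n ≡ g n
open _≋_ public

infixl 6 _⊕_
infixl 7 _⊛_ _·_

_⊕_ : Series → Series → Series
(f ⊕ g) n = f n + g n

tail : Series → Series
tail f n = f (suc n)

_·_ : ℤ → Series → Series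
(a · f) n = a * f n

-- The Cauchy product by structural recursion on the index, which keeps finite sums out of every
-- later proof.
_⊛_ : Series → Series → Series
(f ⊛ g) zero    = f 0 * g 0
(f ⊛ g) (suc n) = f 0 * g (suc n) + (tail f ⊛ g) n

con : ℤ → Series
con a zero    = a
con a (suc n) = 0ℤ

neg : Series → Series
neg f n = - f n

⊛-cong′ : ∀ {f f′ g g′} → (∀ n → f n ≡ f′ n) → (∀ n → g n ≡ g′ n) → ∀ n → (f ⊛ g) n ≡ (f′ ⊛ g′) n
⊛-cong′ p q zero    = cong₂ _*_ (p 0) (q 0)
⊛-cong′ p q (suc n) =
  cong₂ _+_ (cong₂ _*_ (p 0) (q (suc n))) (⊛-cong′ (λ i → p (suc i)) q n)

⊛-distribʳ′ : ∀ h f g n → ((f ⊕ g) ⊛ h) n ≡ (f ⊛ h ⊕ g ⊛ h) n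
⊛-distribʳ′ h f g zero    = ℤ.*-distribʳ-+ (h 0) (f 0) (g 0)
⊛-distribʳ′ h f g (suc n) =
  trans (cong (_+_ ((f 0 + g 0) * h (suc n))) (⊛-distribʳ′ h (tail f) (tail g) n))
        (lemma (f 0) (g 0) (h (suc n)) _ _)
  where
  lemma : ∀ a b c x y → (a + b) * c + (x + y) ≡ (a * c + x) + (b * c + y)
  lemma = solve-∀

·-⊛-assoc′ : ∀ a f g n → ((a · f) ⊛ g) n ≡ (a · (f ⊛ g)) n
·-⊛-assoc′ a f g zero    = ℤ.*-assoc a (f 0) (g 0)
·-⊛-assoc′ a f g (suc n) =
  trans (cong (_+_ (a * f 0 * g (suc n))) (·-⊛-assoc′ a (tail f) g n))
        (lemma a (f 0) (g (suc n)) _)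
  where
  lemma : ∀ a b c x → a * b * c + a * x ≡ a * (b * c + x)
  lemma = solve-∀

⊛-assoc′ : ∀ f g h n → ((f ⊛ g) ⊛ h) n ≡ (f ⊛ (g ⊛ h)) n
⊛-assoc′ f g h zero    = ℤ.*-assoc (f 0) (g 0) (h 0)
⊛-assoc′ f g h (suc n) = begin
  f 0 * g 0 * h (suc n) + (tail (f ⊛ g) ⊛ h) n
    ≡⟨ cong (_+_ (f 0 * g 0 * h (suc n))) (⊛-distribʳ′ h (f 0 · tail g) (tail f ⊛ g) n) ⟩
  f 0 * g 0 * h (suc n) + (((f 0 · tail g) ⊛ h) n + ((tail f ⊛ g) ⊛ h) n)
    ≡⟨ cong (_+_ (f 0 * g 0 * h (suc n)))
         (cong₂ _+_ (·-⊛-assoc′ (f 0) (tail g) h n) (⊛-assoc′ (tail f) g h n)) ⟩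
  f 0 * g 0 * h (suc n) + (f 0 * (tail g ⊛ h) n + (tail f ⊛ (g ⊛ h)) n)
    ≡⟨ lemma (f 0) (g 0) (h (suc n)) _ _ ⟩
  f 0 * (g 0 * h (suc n) + (tail g ⊛ h) n) + (tail f ⊛ (g ⊛ h)) n ∎
  where
  open ≡-Reasoning
  lemma : ∀ a b c x y → a * b * c + (a * x + y) ≡ a * (b * c + x) + y
  lemma = solve-∀

-- The mirror image of the defining recursion, peeling `g` instead of `f`; commutativity is then an
-- induction that exchanges the two.
⊛-sucʳ : ∀ f g n → (f ⊛ g) (suc n) ≡ f (suc n) * g 0 + (f ⊛ tail g) n
⊛-sucʳ f g zero    = ℤ.+-comm (f 0 * g 1) (f 1 * g 0)
⊛-sucʳ f g (suc n) =
  trans (cong (_+_ (f 0 * g (suc (suc n)))) (⊛-sucʳ (tail f) g n))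
        (lemma (f 0 * g (suc (suc n))) (f (suc (suc n)) * g 0) _)
  where
  lemma : ∀ a b c → a + (b + c) ≡ b + (a + c)
  lemma = solve-∀

⊛-comm′ : ∀ f g n → (f ⊛ g) n ≡ (g ⊛ f) n
⊛-comm′ f g zero    = ℤ.*-comm (f 0) (g 0)
⊛-comm′ f g (suc n) =
  trans (cong₂ _+_ (ℤ.*-comm (f 0) (g (suc n))) (⊛-comm′ (tail f) g n)) (sym (⊛-sucʳ g f n))

⊛-zeroˡ : ∀ f n → ((λ _ → 0ℤ) ⊛ f) n ≡ 0ℤ
⊛-zeroˡ f zero    = refl
⊛-zeroˡ f (suc n) = trans (ℤ.+-identityˡ _) (⊛-zeroˡ f n)

con-⊛ : ∀ a f n → (con a ⊛ f) n ≡ a * f n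
con-⊛ a f zero    = refl
con-⊛ a f (suc n) = trans (cong (_+_ (a * f (suc n))) (⊛-zeroˡ f n)) (ℤ.+-identityʳ _)

≋-refl : ∀ {f} → f ≋ f
≋-refl = coeffwise λ _ → refl

≋-sym : ∀ {f g} → f ≋ g → g ≋ f
≋-sym p = coeffwise λ n → sym (coeff p n)

≋-trans : ∀ {f g h} → f ≋ g → g ≋ h → f ≋ h
≋-trans p q = coeffwise λ n → trans (coeff p n) (coeff q n)

⊛-comm : ∀ f g → f ⊛ g ≋ g ⊛ f
⊛-comm f g = coeffwise (⊛-comm′ f g)

isCommutativeRing : IsCommutativeRing _≋_ _⊕_ _⊛_ neg (con 0ℤ) (con 1ℤ)
isCommutativeRing = record
  { isRing = record
    { +-isAbelianGroup = record
      { isGroup = record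
        { isMonoid = record
          { isSemigroup = record
            { isMagma = record
              { isEquivalence = record { refl = ≋-refl ; sym = ≋-sym ; trans = ≋-trans }
              ; ∙-cong = λ p q → coeffwise λ n → cong₂ _+_ (coeff p n) (coeff q n) }
            ; assoc = λ f g h → coeffwise λ n → ℤ.+-assoc (f n) (g n) (h n) }
          ; identity = zero-identityˡ
                     , λ f → ≋-trans (coeffwise λ n → ℤ.+-comm (f n) (con 0ℤ n)) (zero-identityˡ f) }
        ; inverse = neg-inverseˡ
                  , λ f → ≋-trans (coeffwise λ n → ℤ.+-comm (f n) (- f n)) (neg-inverseˡ f)
        ; ⁻¹-cong = λ p → coeffwise λ n → cong -_ (coeff p n) }
      ; comm = λ f g → coeffwise λ n → ℤ.+-comm (f n) (g n) }
    ; *-cong = λ p q → coeffwise (⊛-cong′ (coeff p) (coeff q))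
    ; *-assoc = λ f g h → coeffwise (⊛-assoc′ f g h)
    ; *-identity = one-identityˡ , λ f → ≋-trans (⊛-comm f (con 1ℤ)) (one-identityˡ f)
    ; distrib = (λ f g h → ≋-trans (⊛-comm f (g ⊕ h)) (≋-trans (coeffwise (⊛-distribʳ′ f g h))
                  (coeffwise λ n → cong₂ _+_ (⊛-comm′ g f n) (⊛-comm′ h f n))))
              , λ f g h → coeffwise (⊛-distribʳ′ f g h) }
  ; *-comm = ⊛-comm }
  where
  zero-identityˡ : ∀ f → con 0ℤ ⊕ f ≋ f
  zero-identityˡ f = coeffwise λ { zero → ℤ.+-identityˡ _ ; (suc n) → ℤ.+-identityˡ _ }
  neg-inverseˡ : ∀ f → neg f ⊕ f ≋ con 0ℤ
  neg-inverseˡ f = coeffwise λ { zero → ℤ.+-inverseˡ (f 0) ; (suc n) → ℤ.+-inverseˡ (f (suc n)) }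
  one-identityˡ : ∀ f → con 1ℤ ⊛ f ≋ f
  one-identityˡ f = coeffwise λ n → trans (con-⊛ 1ℤ f n) (ℤ.*-identityˡ (f n))

seriesRing : CommutativeRing 0ℓ 0ℓ
seriesRing = record { isCommutativeRing = isCommutativeRing }

open import Algebra.Solver.Ring.NaturalCoefficients.Default (CommutativeRing.commutativeSemiring seriesRing)
  using (solve; _:+_; _:*_; _:=_) renaming (con to :con)

module ≋-Reasoning where
  open import Relation.Binary.Reasoning.Setoid (CommutativeRing.setoid seriesRing) public

⊕-cong : ∀ {f f′ g g′} → f ≋ f′ → g ≋ g′ → f ⊕ g ≋ f′ ⊕ g′
⊕-cong = CommutativeRing.+-cong seriesRing

⊛-cong : ∀ {f f′ g g′} → f ≋ f′ → g ≋ g′ → f ⊛ g ≋ f′ ⊛ g′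
⊛-cong = CommutativeRing.*-cong seriesRing

⊛-congˡ : ∀ f {g g′} → g ≋ g′ → f ⊛ g ≋ f ⊛ g′
⊛-congˡ f = ⊛-cong (≋-refl {f})

⊛-congʳ : ∀ {f f′} g → f ≋ f′ → f ⊛ g ≋ f′ ⊛ g
⊛-congʳ g p = ⊛-cong p (≋-refl {g})

⊛-assoc : ∀ f g h → (f ⊛ g) ⊛ h ≋ f ⊛ (g ⊛ h)
⊛-assoc = CommutativeRing.*-assoc seriesRing

⊛-identityˡ : ∀ f → con 1ℤ ⊛ f ≋ f
⊛-identityˡ = CommutativeRing.*-identityˡ seriesRing

interchange : ∀ f g h k → (f ⊛ g) ⊛ (h ⊛ k) ≋ (f ⊛ h) ⊛ (g ⊛ k)
interchange = solve 4 (λ f g h k → (f :* g) :* (h :* k) := (f :* h) :* (g :* k)) ≋-refl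

con-cong : ∀ {a b} → a ≡ b → con a ≋ con b
con-cong refl = ≋-refl

con-+ : ∀ a b → con (a + b) ≋ con a ⊕ con b
con-+ a b = coeffwise λ { zero → refl ; (suc n) → refl }

con-* : ∀ a b → con (a * b) ≋ con a ⊛ con b
con-* a b = coeffwise λ { zero → refl ; (suc n) → sym (trans (con-⊛ a (con b) (suc n)) (ℤ.*-zeroʳ a)) }

-- Linear factors, finite products and Stirling numbers.

Y : Series
Y zero    = 0ℤ
Y (suc n) = con 1ℤ n

Y-⊛-suc : ∀ f n → (Y ⊛ f) (suc n) ≡ f n
Y-⊛-suc f n = trans (ℤ.+-identityˡ _) (trans (con-⊛ 1ℤ f n) (ℤ.*-identityˡ (f n)))

lin : ℤ → ℤ → Series
lin a b = con b ⊕ con a ⊛ Y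

lin-cong : ∀ {a a′ b b′} → a ≡ a′ → b ≡ b′ → lin a b ≋ lin a′ b′
lin-cong refl refl = ≋-refl

⊛-lin-zero : ∀ f a b → (f ⊛ lin a b) 0 ≡ b * f 0
⊛-lin-zero f a b = lemma (f 0) a b
  where
  lemma : ∀ x a b → x * (b + a * 0ℤ) ≡ b * x
  lemma = solve-∀

⊛-lin-suc : ∀ f a b n → (f ⊛ lin a b) (suc n) ≡ b * f (suc n) + a * f n
⊛-lin-suc f a b n = trans (coeff (rearrange f (con a) (con b) Y) (suc n))
  (cong₂ _+_ (con-⊛ b f (suc n)) (trans (con-⊛ a (Y ⊛ f) (suc n)) (cong (a *_) (Y-⊛-suc f n))))
  where
  rearrange : ∀ f a b y → f ⊛ (b ⊕ a ⊛ y) ≋ b ⊛ f ⊕ a ⊛ (y ⊛ f)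
  rearrange = solve 4 (λ f a b y → f :* (b :+ a :* y) := b :* f :+ a :* (y :* f)) ≋-refl

con-⊛-lin : ∀ d a b → con d ⊛ lin a b ≋ lin (d * a) (d * b)
con-⊛-lin d a b = ≋-trans (rearrange (con d) (con a) (con b) Y)
  (≋-sym (⊕-cong (con-* d b) (⊛-congʳ Y (con-* d a))))
  where
  rearrange : ∀ d a b y → d ⊛ (b ⊕ a ⊛ y) ≋ d ⊛ b ⊕ (d ⊛ a) ⊛ y
  rearrange = solve 4 (λ d a b y → d :* (b :+ a :* y) := d :* b :+ (d :* a) :* y) ≋-refl

Π : ℕ → (ℕ → Series) → Series
Π zero    φ = con 1ℤ
Π (suc n) φ = Π n φ ⊛ φ n

Π-cong : ∀ n {φ ψ} → (∀ i → φ i ≋ ψ i) → Π n φ ≋ Π n ψ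
Π-cong zero    p = ≋-refl
Π-cong (suc n) p = ⊛-cong (Π-cong n p) (p n)

Π-suc : ∀ n φ → Π (suc n) φ ≋ φ 0 ⊛ Π n (λ i → φ (suc i))
Π-suc zero    φ = ⊛-comm (con 1ℤ) (φ 0)
Π-suc (suc n) φ = ≋-trans (⊛-congʳ (φ (suc n)) (Π-suc n φ)) (⊛-assoc (φ 0) _ _)

Π-+ : ∀ m n φ → Π (m ℕ.+ n) φ ≋ Π m φ ⊛ Π n (λ i → φ (m ℕ.+ i))
Π-+ zero    n φ = ≋-sym (⊛-identityˡ (Π n φ))
Π-+ (suc m) n φ = begin
  Π (suc (m ℕ.+ n)) φ                              ≈⟨ Π-suc (m ℕ.+ n) φ ⟩
  φ 0 ⊛ Π (m ℕ.+ n) (λ i → φ (suc i))              ≈⟨ ⊛-congˡ (φ 0) (Π-+ m n (λ i → φ (suc i))) ⟩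
  φ 0 ⊛ (Π m (λ i → φ (suc i)) ⊛ Π n (λ i → φ (suc m ℕ.+ i)))
                                                   ≈⟨ ⊛-assoc (φ 0) _ _ ⟨
  (φ 0 ⊛ Π m (λ i → φ (suc i))) ⊛ Π n (λ i → φ (suc m ℕ.+ i))
                                                   ≈⟨ ⊛-congʳ _ (Π-suc m φ) ⟨
  Π (suc m) φ ⊛ Π n (λ i → φ (suc m ℕ.+ i))        ∎
  where open ≋-Reasoning

Π-⊛ : ∀ n φ ψ → Π n (λ i → φ i ⊛ ψ i) ≋ Π n φ ⊛ Π n ψ
Π-⊛ zero    φ ψ = ≋-sym (⊛-identityˡ (con 1ℤ))
Π-⊛ (suc n) φ ψ = ≋-trans (⊛-congʳ (φ n ⊛ ψ n) (Π-⊛ n φ ψ)) (interchange (Π n φ) (Π n ψ) (φ n) (ψ n))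

Π-con : ∀ n a → Π n (λ _ → con a) ≋ con (a ^ᶻ n)
Π-con zero    a = ≋-refl
Π-con (suc n) a =
  ≋-trans (⊛-congʳ (con a) (Π-con n a)) (≋-trans (⊛-comm (con (a ^ᶻ n)) (con a)) (≋-sym (con-* a (a ^ᶻ n))))

Π-triples : ∀ n φ → Π (n ℕ.* 3) φ ≋
  Π n (λ j → φ (j ℕ.* 3) ⊛ (φ (1 ℕ.+ j ℕ.* 3) ⊛ φ (2 ℕ.+ j ℕ.* 3)))
Π-triples zero    φ = ≋-refl
Π-triples (suc n) φ = ≋-trans
  (⊛-congʳ (φ (2 ℕ.+ n ℕ.* 3)) (⊛-congʳ (φ (1 ℕ.+ n ℕ.* 3)) (⊛-congʳ (φ (n ℕ.* 3)) (Π-triples n φ))))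
  (rearrange _ _ _ _)
  where
  rearrange : ∀ f x y z → f ⊛ x ⊛ y ⊛ z ≋ f ⊛ (x ⊛ (y ⊛ z))
  rearrange = solve 4 (λ f x y z → f :* x :* y :* z := f :* (x :* (y :* z))) ≋-refl

-- The numbers i - n with i < n are exactly -n, ..., -1. Peeling off the factor at -n leaves the
-- same situation one step smaller.
Π-reverse : ∀ n (ψ : ℤ → Series) → Π n (λ i → ψ (+ i - + n)) ≋ Π n (λ i → ψ (- + suc i))
Π-reverse zero    ψ = ≋-refl
Π-reverse (suc n) ψ = begin
  Π (suc n) (λ i → ψ (+ i - + suc n))                ≈⟨ Π-suc n (λ i → ψ (+ i - + suc n)) ⟩
  ψ (- + suc n) ⊛ Π n (λ i → ψ (+ suc i - + suc n))  ≈⟨ ⊛-congˡ (ψ (- + suc n)) (≋-trans (Π-cong n step) (Π-reverse n ψ)) ⟩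
  ψ (- + suc n) ⊛ Π n (λ i → ψ (- + suc i))          ≈⟨ ⊛-comm (ψ (- + suc n)) _ ⟩
  Π (suc n) (λ i → ψ (- + suc i))                    ∎
  where
  open ≋-Reasoning
  lemma : ∀ a b → (1ℤ + a) - (1ℤ + b) ≡ a - b
  lemma = solve-∀
  step : ∀ i → ψ (+ suc i - + suc n) ≋ ψ (+ i - + n)
  step i = subst (λ z → ψ z ≋ ψ (+ i - + n)) (sym (lemma (+ i) (+ n))) ≋-refl

-- The product is the rising factorial of a y: multiplication by a y + n acts on coefficients by the
-- recurrence that defines `stirling1`.
Π-lin-coeff : ∀ a n k → Π n (λ i → lin a (+ i)) k ≡ a ^ᶻ k * + stirling1 n k
Π-lin-coeff a zero    zero    = refl
Π-lin-coeff a zero    (suc k) = sym (ℤ.*-zeroʳ (a ^ᶻ suc k))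
Π-lin-coeff a (suc n) zero    = trans (⊛-lin-zero f a (+ n)) (trans (cong (+ n *_) (Π-lin-coeff a n 0)) (lemma n))
  where
  f = Π n (λ i → lin a (+ i))
  lemma : ∀ n → + n * (1ℤ * + stirling1 n 0) ≡ 0ℤ
  lemma zero    = refl
  lemma (suc n) = ℤ.*-zeroʳ (+ suc n)
Π-lin-coeff a (suc n) (suc k) = begin
  (f ⊛ lin a (+ n)) (suc k)
    ≡⟨ ⊛-lin-suc f a (+ n) k ⟩
  + n * f (suc k) + a * f k
    ≡⟨ cong₂ (λ x y → + n * x + a * y) (Π-lin-coeff a n (suc k)) (Π-lin-coeff a n k) ⟩
  + n * (a * a ^ᶻ k * + stirling1 n (suc k)) + a * (a ^ᶻ k * + stirling1 n k)
    ≡⟨ lemma (+ n) a (a ^ᶻ k) _ _ ⟩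
  a * a ^ᶻ k * (+ n * + stirling1 n (suc k) + + stirling1 n k)
    ≡⟨ cong (λ z → a * a ^ᶻ k * (z + + stirling1 n k)) (ℤ.pos-* n _) ⟨
  a ^ᶻ suc k * + stirling1 (suc n) (suc k) ∎
  where
  open ≡-Reasoning
  f = Π n (λ i → lin a (+ i))
  lemma : ∀ n a p x y → n * (a * p * x) + a * (p * y) ≡ a * p * (n * x + y)
  lemma = solve-∀

-- Derivatives and Taylor expansion to second order.

D : Series → Series
D f n = + suc n * f (suc n)

D-cong : ∀ {f g} → f ≋ g → D f ≋ D g
D-cong p = coeffwise λ n → cong (+ suc n *_) (coeff p (suc n))

D-⊕ : ∀ f g → D (f ⊕ g) ≋ D f ⊕ D g
D-⊕ f g = coeffwise λ n → ℤ.*-distribˡ-+ (+ suc n) (f (suc n)) (g (suc n))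

-- The Euler operator y d/dy is a derivation with the same recursion as ⊛, unlike d/dy.
θ : Series → Series
θ f n = + n * f n

θ-⊛ : ∀ f g n → θ (f ⊛ g) n ≡ (θ f ⊛ g) n + (f ⊛ θ g) n
θ-⊛ f g zero    = sym (trans (ℤ.+-identityˡ _) (ℤ.*-zeroʳ (f 0)))
θ-⊛ f g (suc n) = begin
  + suc n * (f 0 * g (suc n) + (tail f ⊛ g) n)
    ≡⟨ lemma₁ (+ n) (f 0) (g (suc n)) ((tail f ⊛ g) n) ⟩
  f 0 * (+ suc n * g (suc n)) + (θ (tail f ⊛ g) n + (tail f ⊛ g) n)
    ≡⟨ cong (λ z → f 0 * (+ suc n * g (suc n)) + (z + (tail f ⊛ g) n)) (θ-⊛ (tail f) g n) ⟩
  f 0 * (+ suc n * g (suc n)) + ((θ (tail f) ⊛ g) n + (tail f ⊛ θ g) n + (tail f ⊛ g) n)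
    ≡⟨ lemma₂ (f 0 * (+ suc n * g (suc n))) ((θ (tail f) ⊛ g) n) ((tail f ⊛ θ g) n) ((tail f ⊛ g) n) ⟩
  0ℤ * f 0 * g (suc n) + ((θ (tail f) ⊛ g) n + (tail f ⊛ g) n) + (f ⊛ θ g) (suc n)
    ≡⟨ cong (λ z → 0ℤ * f 0 * g (suc n) + z + (f ⊛ θ g) (suc n)) (⊛-distribʳ′ g (θ (tail f)) (tail f) n) ⟨
  0ℤ * f 0 * g (suc n) + ((θ (tail f) ⊕ tail f) ⊛ g) n + (f ⊛ θ g) (suc n)
    ≡⟨ cong (λ z → 0ℤ * f 0 * g (suc n) + z + (f ⊛ θ g) (suc n))
         (⊛-cong′ (λ i → lemma₃ (+ i) (f (suc i))) (λ _ → refl) n) ⟩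
  (θ f ⊛ g) (suc n) + (f ⊛ θ g) (suc n) ∎
  where
  open ≡-Reasoning
  lemma₁ : ∀ n a b x → (1ℤ + n) * (a * b + x) ≡ a * ((1ℤ + n) * b) + (n * x + x)
  lemma₁ = solve-∀
  lemma₂ : ∀ c x y z → c + (x + y + z) ≡ 0ℤ + (x + z) + (c + y)
  lemma₂ = solve-∀
  lemma₃ : ∀ n x → n * x + x ≡ (1ℤ + n) * x
  lemma₃ = solve-∀

D-⊛ : ∀ f g → D (f ⊛ g) ≋ D f ⊛ g ⊕ f ⊛ D g
D-⊛ f g = coeffwise λ n → begin
  θ (f ⊛ g) (suc n)                                ≡⟨ θ-⊛ f g (suc n) ⟩
  (θ f ⊛ g) (suc n) + (f ⊛ θ g) (suc n)
    ≡⟨ cong₂ _+_ (lemma₁ (f 0) (g (suc n)) ((D f ⊛ g) n)) (trans (⊛-sucʳ f (θ g) n) (lemma₂ (f (suc n)) (g 0) ((f ⊛ D g) n))) ⟩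
  (D f ⊛ g) n + (f ⊛ D g) n                        ∎
  where
  open ≡-Reasoning
  lemma₁ : ∀ a b x → 0ℤ * a * b + x ≡ x
  lemma₁ = solve-∀
  lemma₂ : ∀ a b x → a * (0ℤ * b) + x ≡ x
  lemma₂ = solve-∀

D-D-⊛ : ∀ f g → D (D (f ⊛ g)) ≋ D (D f) ⊛ g ⊕ con (+ 2) ⊛ (D f ⊛ D g) ⊕ f ⊛ D (D g)
D-D-⊛ f g = begin
  D (D (f ⊛ g))                                                   ≈⟨ D-cong (D-⊛ f g) ⟩
  D (D f ⊛ g ⊕ f ⊛ D g)                                           ≈⟨ D-⊕ (D f ⊛ g) (f ⊛ D g) ⟩
  D (D f ⊛ g) ⊕ D (f ⊛ D g)                                       ≈⟨ ⊕-cong (D-⊛ (D f) g) (D-⊛ f (D g)) ⟩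
  (D (D f) ⊛ g ⊕ D f ⊛ D g) ⊕ (D f ⊛ D g ⊕ f ⊛ D (D g))           ≈⟨ rearrange (D (D f) ⊛ g) (D f ⊛ D g) (f ⊛ D (D g)) ⟩
  D (D f) ⊛ g ⊕ (con 1ℤ ⊕ con 1ℤ) ⊛ (D f ⊛ D g) ⊕ f ⊛ D (D g)
    ≈⟨ ⊕-cong (⊕-cong (≋-refl {D (D f) ⊛ g}) (⊛-congʳ (D f ⊛ D g) (≋-sym (con-+ 1ℤ 1ℤ)))) ≋-refl ⟩
  D (D f) ⊛ g ⊕ con (+ 2) ⊛ (D f ⊛ D g) ⊕ f ⊛ D (D g)             ∎
  where
  open ≋-Reasoning
  rearrange : ∀ x y z → (x ⊕ y) ⊕ (y ⊕ z) ≋ x ⊕ (con 1ℤ ⊕ con 1ℤ) ⊛ y ⊕ z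
  rearrange = solve 3 (λ x y z → (x :+ y) :+ (y :+ z) := x :+ (:con 1 :+ :con 1) :* y :+ z) ≋-refl

-- g is f(y + h).
record Expansion (h : ℤ) (f g : Series) : Set where
  field
    second remainder : Series
    expansion : g ≋ f ⊕ con h ⊛ D f ⊕ con h ⊛ con h ⊛ second ⊕ con h ⊛ con h ⊛ con h ⊛ remainder
    twice-second : con (+ 2) ⊛ second ≋ D (D f)
open Expansion public

-- Multiplying two truncated expansions, the terms in h and h² are the Leibniz rules for first and
-- second derivatives, and whatever carries h³ goes into the remainder. Hence only linear factors
-- have to be expanded directly.
Expansion-⊛ : ∀ {h f g f′ g′} → Expansion h f g → Expansion h f′ g′ → Expansion h (f ⊛ f′) (g ⊛ g′)
Expansion-⊛ {h} {f} {g} {f′} {g′} E E′ = record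
  { second = s ⊛ f′ ⊕ d ⊛ d′ ⊕ f ⊛ s′
  ; remainder = f ⊛ r′ ⊕ d ⊛ s′ ⊕ s ⊛ d′ ⊕ r ⊛ f′ ⊕ H ⊛ (d ⊛ r′ ⊕ s ⊛ s′ ⊕ r ⊛ d′)
      ⊕ H ⊛ H ⊛ (s ⊛ r′ ⊕ r ⊛ s′) ⊕ H ⊛ H ⊛ H ⊛ (r ⊛ r′)
  ; expansion = ≋-trans (⊛-cong (expansion E) (expansion E′)) (≋-trans (multiply H f d s r f′ d′ s′ r′)
      (⊕-cong (⊕-cong (⊕-cong (≋-refl {f ⊛ f′}) (⊛-congˡ H (≋-sym (D-⊛ f f′)))) ≋-refl) ≋-refl))
  ; twice-second = ≋-trans (distribute (con (+ 2)) f d s f′ d′ s′)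
      (≋-trans (⊕-cong (⊕-cong (⊛-congʳ f′ (twice-second E)) (≋-refl {con (+ 2) ⊛ (d ⊛ d′)}))
                       (⊛-congˡ f (twice-second E′)))
               (≋-sym (D-D-⊛ f f′))) }
  where
  H = con h
  d = D f
  d′ = D f′
  s = second E
  s′ = second E′
  r = remainder E
  r′ = remainder E′
  multiply : ∀ h f d s r f′ d′ s′ r′ →
    (f ⊕ h ⊛ d ⊕ h ⊛ h ⊛ s ⊕ h ⊛ h ⊛ h ⊛ r) ⊛ (f′ ⊕ h ⊛ d′ ⊕ h ⊛ h ⊛ s′ ⊕ h ⊛ h ⊛ h ⊛ r′) ≋
    f ⊛ f′ ⊕ h ⊛ (d ⊛ f′ ⊕ f ⊛ d′) ⊕ h ⊛ h ⊛ (s ⊛ f′ ⊕ d ⊛ d′ ⊕ f ⊛ s′) ⊕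
    h ⊛ h ⊛ h ⊛ (f ⊛ r′ ⊕ d ⊛ s′ ⊕ s ⊛ d′ ⊕ r ⊛ f′ ⊕ h ⊛ (d ⊛ r′ ⊕ s ⊛ s′ ⊕ r ⊛ d′)
      ⊕ h ⊛ h ⊛ (s ⊛ r′ ⊕ r ⊛ s′) ⊕ h ⊛ h ⊛ h ⊛ (r ⊛ r′))
  multiply = solve 9 (λ h f d s r f′ d′ s′ r′ →
    (f :+ h :* d :+ h :* h :* s :+ h :* h :* h :* r) :* (f′ :+ h :* d′ :+ h :* h :* s′ :+ h :* h :* h :* r′) :=
    f :* f′ :+ h :* (d :* f′ :+ f :* d′) :+ h :* h :* (s :* f′ :+ d :* d′ :+ f :* s′) :+
    h :* h :* h :* (f :* r′ :+ d :* s′ :+ s :* d′ :+ r :* f′ :+ h :* (d :* r′ :+ s :* s′ :+ r :* d′)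
      :+ h :* h :* (s :* r′ :+ r :* s′) :+ h :* h :* h :* (r :* r′))) ≋-refl
  distribute : ∀ t f d s f′ d′ s′ → t ⊛ (s ⊛ f′ ⊕ d ⊛ d′ ⊕ f ⊛ s′) ≋ t ⊛ s ⊛ f′ ⊕ t ⊛ (d ⊛ d′) ⊕ f ⊛ (t ⊛ s′)
  distribute = solve 7 (λ t f d s f′ d′ s′ →
    t :* (s :* f′ :+ d :* d′ :+ f :* s′) := t :* s :* f′ :+ t :* (d :* d′) :+ f :* (t :* s′)) ≋-refl

D-lin : ∀ a b → D (lin a b) ≋ con a
D-lin a b = coeffwise λ
  { zero    → trans (cong (λ z → 1ℤ * (0ℤ + z)) (con-⊛ a Y 1)) (lemma₀ a)
  ; (suc n) → trans (cong (λ z → + suc (suc n) * (0ℤ + z)) (con-⊛ a Y (suc (suc n)))) (lemma₁ (+ suc (suc n)) a) }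
  where
  lemma₀ : ∀ a → 1ℤ * (0ℤ + a * 1ℤ) ≡ a
  lemma₀ = solve-∀
  lemma₁ : ∀ m a → m * (0ℤ + a * 0ℤ) ≡ 0ℤ
  lemma₁ = solve-∀

D-con : ∀ a → D (con a) ≋ con 0ℤ
D-con a = coeffwise λ { zero → refl ; (suc n) → ℤ.*-zeroʳ (+ suc (suc n)) }

Expansion-lin : ∀ h a b → Expansion h (lin a b) (lin a (b + a * h))
Expansion-lin h a b = record
  { second = con 0ℤ
  ; remainder = con 0ℤ
  ; expansion = ≋-trans (⊕-cong (≋-trans (con-+ b (a * h)) (⊕-cong (≋-refl {con b}) (con-* a h))) ≋-refl)
      (≋-trans (rearrange (con h) (con a) (con b) Y)
        (⊕-cong (⊕-cong (⊕-cong (≋-refl {lin a b}) (⊛-congˡ (con h) (≋-sym (D-lin a b))))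
          ≋-refl) ≋-refl))
  ; twice-second = ≋-trans (≋-trans (≋-sym (con-* (+ 2) 0ℤ)) (≋-sym (D-con a))) (D-cong (≋-sym (D-lin a b))) }
  where
  rearrange : ∀ h a b y → b ⊕ a ⊛ h ⊕ a ⊛ y ≋ b ⊕ a ⊛ y ⊕ h ⊛ a ⊕ h ⊛ h ⊛ con 0ℤ ⊕ h ⊛ h ⊛ h ⊛ con 0ℤ
  rearrange = solve 4 (λ h a b y → b :+ a :* h :+ a :* y :=
    b :+ a :* y :+ h :* a :+ h :* h :* :con 0 :+ h :* h :* h :* :con 0) ≋-refl

Expansion-1 : ∀ h → Expansion h (con 1ℤ) (con 1ℤ)
Expansion-1 h = record
  { second = con 0ℤ
  ; remainder = con 0ℤ
  ; expansion = ≋-trans (rearrange (con h))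
      (⊕-cong (⊕-cong (⊕-cong (≋-refl {con 1ℤ}) (⊛-congˡ (con h) (≋-sym (D-con 1ℤ)))) ≋-refl) ≋-refl)
  ; twice-second = ≋-trans (≋-sym (con-* (+ 2) 0ℤ)) (≋-trans (≋-sym (D-con 0ℤ)) (D-cong (≋-sym (D-con 1ℤ)))) }
  where
  rearrange : ∀ h → con 1ℤ ≋ con 1ℤ ⊕ h ⊛ con 0ℤ ⊕ h ⊛ h ⊛ con 0ℤ ⊕ h ⊛ h ⊛ h ⊛ con 0ℤ
  rearrange = solve 1 (λ h → :con 1 := :con 1 :+ h :* :con 0 :+ h :* h :* :con 0 :+ h :* h :* h :* :con 0) ≋-refl

Expansion-Π : ∀ {h} n {φ ψ} → (∀ i → Expansion h (φ i) (ψ i)) → Expansion h (Π n φ) (Π n ψ)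
Expansion-Π {h} zero    E = Expansion-1 h
Expansion-Π     (suc n) E = Expansion-⊛ (Expansion-Π n E) (E n)

-- The substitution of -y for y.

reflect : Series → Series
reflect f n = (- 1ℤ) ^ᶻ n * f n

reflect-⊛′ : ∀ f g n → reflect (f ⊛ g) n ≡ (reflect f ⊛ reflect g) n
reflect-⊛′ f g zero    = lemma (f 0) (g 0)
  where
  lemma : ∀ a b → 1ℤ * (a * b) ≡ 1ℤ * a * (1ℤ * b)
  lemma = solve-∀
reflect-⊛′ f g (suc n) = begin
  - 1ℤ * p * (f 0 * g (suc n) + (tail f ⊛ g) n)
    ≡⟨ lemma p (f 0) (g (suc n)) _ ⟩
  1ℤ * f 0 * (- 1ℤ * p * g (suc n)) + - 1ℤ * reflect (tail f ⊛ g) n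
    ≡⟨ cong (λ z → 1ℤ * f 0 * (- 1ℤ * p * g (suc n)) + - 1ℤ * z) (reflect-⊛′ (tail f) g n) ⟩
  1ℤ * f 0 * (- 1ℤ * p * g (suc n)) + - 1ℤ * (reflect (tail f) ⊛ reflect g) n
    ≡⟨ cong (_+_ (1ℤ * f 0 * (- 1ℤ * p * g (suc n)))) (·-⊛-assoc′ (- 1ℤ) (reflect (tail f)) (reflect g) n) ⟨
  1ℤ * f 0 * (- 1ℤ * p * g (suc n)) + ((- 1ℤ · reflect (tail f)) ⊛ reflect g) n
    ≡⟨ cong (_+_ (1ℤ * f 0 * (- 1ℤ * p * g (suc n))))
         (⊛-cong′ (λ i → sym (ℤ.*-assoc (- 1ℤ) ((- 1ℤ) ^ᶻ i) (f (suc i)))) (λ _ → refl) n) ⟩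
  (reflect f ⊛ reflect g) (suc n) ∎
  where
  open ≡-Reasoning
  p = (- 1ℤ) ^ᶻ n
  lemma : ∀ p a b x → - 1ℤ * p * (a * b + x) ≡ 1ℤ * a * (- 1ℤ * p * b) + - 1ℤ * (p * x)
  lemma = solve-∀

reflect-⊛ : ∀ f g → reflect (f ⊛ g) ≋ reflect f ⊛ reflect g
reflect-⊛ f g = coeffwise (reflect-⊛′ f g)

reflect-con : ∀ a → reflect (con a) ≋ con a
reflect-con a = coeffwise λ { zero → ℤ.*-identityˡ a ; (suc n) → ℤ.*-zeroʳ ((- 1ℤ) ^ᶻ suc n) }

reflect-Π : ∀ n φ → reflect (Π n φ) ≋ Π n (λ i → reflect (φ i))
reflect-Π zero    φ = reflect-con 1ℤ
reflect-Π (suc n) φ = ≋-trans (reflect-⊛ (Π n φ) (φ n)) (⊛-congʳ (reflect (φ n)) (reflect-Π n φ))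

reflect-Y : reflect Y ≋ con (- 1ℤ) ⊛ Y
reflect-Y = coeffwise λ
  { zero          → refl
  ; (suc zero)    → refl
  ; (suc (suc n)) → trans (ℤ.*-zeroʳ ((- 1ℤ) ^ᶻ suc (suc n))) (sym (con-⊛ (- 1ℤ) Y (suc (suc n)))) }

reflect-⊕ : ∀ f g → reflect (f ⊕ g) ≋ reflect f ⊕ reflect g
reflect-⊕ f g = coeffwise λ n → ℤ.*-distribˡ-+ ((- 1ℤ) ^ᶻ n) (f n) (g n)

-- -b + a y = -(b + a (-y)). This turns a product over negated offsets into a reflected product, up
-- to sign.
lin-neg : ∀ a b → lin a (- b) ≋ con (- 1ℤ) ⊛ reflect (lin a b)
lin-neg a b = begin
  con (- b) ⊕ con a ⊛ Y
    ≈⟨ ⊕-cong (con-cong (lemma₁ b)) (⊛-congʳ Y (con-cong (lemma₂ a))) ⟩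
  con (- 1ℤ * b) ⊕ con (- 1ℤ * (- 1ℤ * a)) ⊛ Y
    ≈⟨ ⊕-cong (con-* (- 1ℤ) b) (⊛-congʳ Y (≋-trans (con-* (- 1ℤ) (- 1ℤ * a)) (⊛-congˡ (con (- 1ℤ)) (con-* (- 1ℤ) a)))) ⟩
  con (- 1ℤ) ⊛ con b ⊕ con (- 1ℤ) ⊛ (con (- 1ℤ) ⊛ con a) ⊛ Y
    ≈⟨ rearrange (con (- 1ℤ)) (con a) (con b) Y ⟩
  con (- 1ℤ) ⊛ (con b ⊕ con a ⊛ (con (- 1ℤ) ⊛ Y))
    ≈⟨ ⊛-congˡ (con (- 1ℤ)) (⊕-cong (reflect-con b) (≋-trans (reflect-⊛ (con a) Y) (⊛-cong (reflect-con a) reflect-Y))) ⟨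
  con (- 1ℤ) ⊛ (reflect (con b) ⊕ reflect (con a ⊛ Y))
    ≈⟨ ⊛-congˡ (con (- 1ℤ)) (reflect-⊕ (con b) (con a ⊛ Y)) ⟨
  con (- 1ℤ) ⊛ reflect (lin a b) ∎
  where
  open ≋-Reasoning
  lemma₁ : ∀ b → - b ≡ - 1ℤ * b
  lemma₁ = solve-∀
  lemma₂ : ∀ a → a ≡ - 1ℤ * (- 1ℤ * a)
  lemma₂ = solve-∀
  rearrange : ∀ m a b y → m ⊛ b ⊕ m ⊛ (m ⊛ a) ⊛ y ≋ m ⊛ (b ⊕ a ⊛ (m ⊛ y))
  rearrange = solve 4 (λ m a b y → m :* b :+ m :* (m :* a) :* y := m :* (b :+ a :* (m :* y))) ≋-refl

-- The polynomials `P`: content, translation and symmetry.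

-- This is 3^e n. Multiplying by 3 on the right makes `block (suc e) n` fit `Π-triples` without
-- rewriting.
block : ℕ → ℕ → ℕ
block zero    n = n
block (suc e) n = block e n ℕ.* 3

factor : ℤ → ℤ → ℕ → Series
factor α c i = lin α (+ i + α * c)

-- For α = 3^(e+1), the two factors of a triple that are not divisible by 3; the third, at offset
-- 3j, is 3 times the j-th factor one level down.
pair : ℤ → ℤ → ℕ → Series
pair α c j = factor α c (1 ℕ.+ j ℕ.* 3) ⊛ factor α c (2 ℕ.+ j ℕ.* 3)

-- P e n c is ∏_{i < 3^e n} (3^e (y + c) + i) with the power of 3 in the content of each factor divided out.
P : ℕ → ℕ → ℤ → Series
P zero    n c = Π n (factor 1ℤ c)
P (suc e) n c = P e n c ⊛ Π (block e n) (pair ((+ 3) ^ᶻ suc e) c)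

-- The exponent of 3 lost in passing to P.
content-exponent : ℕ → ℕ → ℕ
content-exponent zero    n = 0
content-exponent (suc e) n = block e n ℕ.+ content-exponent e n

block-pos : ∀ e n → + block e n ≡ (+ 3) ^ᶻ e * + n
block-pos zero    n = sym (ℤ.*-identityˡ (+ n))
block-pos (suc e) n = begin
  + (block e n ℕ.* 3)     ≡⟨ ℤ.pos-* (block e n) 3 ⟩
  + block e n * + 3       ≡⟨ cong (_* + 3) (block-pos e n) ⟩
  (+ 3) ^ᶻ e * + n * + 3   ≡⟨ lemma ((+ 3) ^ᶻ e) (+ n) ⟩
  (+ 3) ^ᶻ suc e * + n     ∎
  where
  open ≡-Reasoning
  lemma : ∀ p n → p * n * + 3 ≡ + 3 * p * n
  lemma = solve-∀

block-+ : ∀ e m n → block e (m ℕ.+ n) ≡ block e m ℕ.+ block e n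
block-+ zero    m n = refl
block-+ (suc e) m n = trans (cong (ℕ._* 3) (block-+ e m n)) (ℕ.*-distribʳ-+ 3 (block e m) (block e n))

factor-zero : ∀ α i → factor α 0ℤ i ≋ lin α (+ i)
factor-zero α i = lin-cong refl (lemma (+ i) α)
  where
  lemma : ∀ i α → i + α * 0ℤ ≡ i
  lemma = solve-∀

factor-Expansion : ∀ h α c i → Expansion h (factor α c i) (factor α (c + h) i)
factor-Expansion h α c i =
  subst (λ b → Expansion h (factor α c i) (lin α b)) (lemma (+ i) α c h) (Expansion-lin h α (+ i + α * c))
  where
  lemma : ∀ i α c h → i + α * c + α * h ≡ i + α * (c + h)
  lemma = solve-∀

-- Every factor depends on y and c through y + c alone, so raising c by h is the translation of y by
-- h.
P-Expansion : ∀ h e n c → Expansion h (P e n c) (P e n (c + h))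
P-Expansion h zero    n c = Expansion-Π n (factor-Expansion h 1ℤ c)
P-Expansion h (suc e) n c = Expansion-⊛ (P-Expansion h e n c)
  (Expansion-Π (block e n) λ j → Expansion-⊛ (factor-Expansion h ((+ 3) ^ᶻ suc e) c _) (factor-Expansion h ((+ 3) ^ᶻ suc e) c _))

-- Among the factors 3^(e+1) y + i, those with i = 3j are 3 (3^e y + j): they give one factor 3 for
-- each j < 3^e n, and then the same product one level down.
P-scaled : ∀ e n → Π (block e n) (λ i → lin ((+ 3) ^ᶻ e) (+ i)) ≋ con ((+ 3) ^ᶻ content-exponent e n) ⊛ P e n 0ℤ
P-scaled zero    n = ≋-trans (Π-cong n λ i → ≋-sym (factor-zero 1ℤ i)) (≋-sym (⊛-identityˡ _))
P-scaled (suc e) n = begin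
  Π (b ℕ.* 3) (λ i → lin α (+ i))
    ≈⟨ Π-triples b (λ i → lin α (+ i)) ⟩
  Π b (λ j → lin α (+ (j ℕ.* 3)) ⊛ (lin α (+ (1 ℕ.+ j ℕ.* 3)) ⊛ lin α (+ (2 ℕ.+ j ℕ.* 3))))
    ≈⟨ Π-cong b (λ j → ⊛-cong (multiple-of-3 j) (⊛-cong (≋-sym (factor-zero α (1 ℕ.+ j ℕ.* 3))) (≋-sym (factor-zero α (2 ℕ.+ j ℕ.* 3))))) ⟩
  Π b (λ j → (con (+ 3) ⊛ lin ((+ 3) ^ᶻ e) (+ j)) ⊛ pair α 0ℤ j)
    ≈⟨ Π-⊛ b (λ j → con (+ 3) ⊛ lin ((+ 3) ^ᶻ e) (+ j)) (pair α 0ℤ) ⟩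
  Π b (λ j → con (+ 3) ⊛ lin ((+ 3) ^ᶻ e) (+ j)) ⊛ Π b (pair α 0ℤ)
    ≈⟨ ⊛-congʳ (Π b (pair α 0ℤ)) (Π-⊛ b (λ _ → con (+ 3)) (λ j → lin ((+ 3) ^ᶻ e) (+ j))) ⟩
  (Π b (λ _ → con (+ 3)) ⊛ Π b (λ j → lin ((+ 3) ^ᶻ e) (+ j))) ⊛ Π b (pair α 0ℤ)
    ≈⟨ ⊛-congʳ (Π b (pair α 0ℤ)) (⊛-cong (Π-con b (+ 3)) (P-scaled e n)) ⟩
  (con ((+ 3) ^ᶻ b) ⊛ (con ((+ 3) ^ᶻ content-exponent e n) ⊛ P e n 0ℤ)) ⊛ Π b (pair α 0ℤ)
    ≈⟨ rearrange (con ((+ 3) ^ᶻ b)) (con ((+ 3) ^ᶻ content-exponent e n)) (P e n 0ℤ) (Π b (pair α 0ℤ)) ⟩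
  (con ((+ 3) ^ᶻ b) ⊛ con ((+ 3) ^ᶻ content-exponent e n)) ⊛ (P e n 0ℤ ⊛ Π b (pair α 0ℤ))
    ≈⟨ ⊛-congʳ (P (suc e) n 0ℤ) (con-* ((+ 3) ^ᶻ b) ((+ 3) ^ᶻ content-exponent e n)) ⟨
  con ((+ 3) ^ᶻ b * (+ 3) ^ᶻ content-exponent e n) ⊛ P (suc e) n 0ℤ
    ≈⟨ ⊛-congʳ (P (suc e) n 0ℤ) (con-cong (ℤ.^-distribˡ-+-* (+ 3) b (content-exponent e n))) ⟨
  con ((+ 3) ^ᶻ content-exponent (suc e) n) ⊛ P (suc e) n 0ℤ ∎
  where
  open ≋-Reasoning
  b = block e n
  α = (+ 3) ^ᶻ suc e
  multiple-of-3 : ∀ j → lin α (+ (j ℕ.* 3)) ≋ con (+ 3) ⊛ lin ((+ 3) ^ᶻ e) (+ j)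
  multiple-of-3 j = ≋-sym (≋-trans (con-⊛-lin (+ 3) ((+ 3) ^ᶻ e) (+ j))
    (lin-cong refl (trans (ℤ.*-comm (+ 3) (+ j)) (sym (ℤ.pos-* j 3)))))
  rearrange : ∀ x y f g → (x ⊛ (y ⊛ f)) ⊛ g ≋ (x ⊛ y) ⊛ (f ⊛ g)
  rearrange = solve 4 (λ x y f g → (x :* (y :* f)) :* g := (x :* y) :* (f :* g)) ≋-refl

-- 3^e (y + c) + (3^e m + j) = 3^e (y + c + m) + j, so the factors after the first 3^e m form a
-- translate.
P-+ : ∀ e m n c → P e (m ℕ.+ n) c ≋ P e m c ⊛ P e n (c + + m)
P-+ zero    m n c = ≋-trans (Π-+ m n (factor 1ℤ c))
  (⊛-congˡ (Π m (factor 1ℤ c)) (Π-cong n λ i → lin-cong refl (lemma (+ m) (+ i) c)))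
  where
  lemma : ∀ m i c → m + i + 1ℤ * c ≡ i + 1ℤ * (c + m)
  lemma = solve-∀
P-+ (suc e) m n c = begin
  P e (m ℕ.+ n) c ⊛ Π (block e (m ℕ.+ n)) (pair α c)
    ≡⟨ cong (λ b → P e (m ℕ.+ n) c ⊛ Π b (pair α c)) (block-+ e m n) ⟩
  P e (m ℕ.+ n) c ⊛ Π (block e m ℕ.+ block e n) (pair α c)
    ≈⟨ ⊛-cong (P-+ e m n c) (Π-+ (block e m) (block e n) (pair α c)) ⟩
  (P e m c ⊛ P e n (c + + m)) ⊛ (Π (block e m) (pair α c) ⊛ Π (block e n) (λ j → pair α c (block e m ℕ.+ j)))
    ≈⟨ interchange (P e m c) (P e n (c + + m)) (Π (block e m) (pair α c)) _ ⟩
  P (suc e) m c ⊛ (P e n (c + + m) ⊛ Π (block e n) (λ j → pair α c (block e m ℕ.+ j)))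
    ≈⟨ ⊛-congˡ (P (suc e) m c) (⊛-congˡ (P e n (c + + m))
         (Π-cong (block e n) λ j → ⊛-cong (step 1 j) (step 2 j))) ⟩
  P (suc e) m c ⊛ P (suc e) n (c + + m) ∎
  where
  open ≋-Reasoning
  α = (+ 3) ^ᶻ suc e
  lemma : ∀ i m j p c → i + (p * m + j) * + 3 + (+ 3 * p) * c ≡ i + j * + 3 + (+ 3 * p) * (c + m)
  lemma = solve-∀
  step : ∀ i j → factor α c (i ℕ.+ (block e m ℕ.+ j) ℕ.* 3) ≋ factor α (c + + m) (i ℕ.+ j ℕ.* 3)
  step i j = lin-cong refl (trans
    (cong (λ z → + i + z + α * c) (trans (ℤ.pos-* (block e m ℕ.+ j) 3) (cong (λ b → (b + + j) * + 3) (block-pos e m))))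
    (trans (lemma (+ i) (+ m) (+ j) ((+ 3) ^ᶻ e) c)
      (cong (λ z → + i + z + α * (c + + m)) (sym (ℤ.pos-* j 3)))))

-- With N = 3^e n, replacing i by N − i turns ∏ (3^e (y − n) + i) into ∏ (3^e y − i); the two ends of the range
-- account for the linear factors.
P-reflect : ∀ e n → Y ⊛ P e n (- + n) ≋ con ((- 1ℤ) ^ᶻ n) ⊛ (lin 1ℤ (- + n) ⊛ reflect (P e n 0ℤ))
P-reflect zero n = begin
  Y ⊛ Π n (factor 1ℤ (- + n))
    ≈⟨ ⊛-congˡ Y (Π-cong n λ i → lin-cong refl (lemma (+ i) (+ n))) ⟩
  Y ⊛ Π n (λ i → lin 1ℤ (+ i - + n))
    ≈⟨ ⊛-cong Y-lin (Π-reverse n (lin 1ℤ)) ⟩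
  lin 1ℤ 0ℤ ⊛ Π n (λ i → lin 1ℤ (- + suc i))
    ≈⟨ Π-suc n (λ i → lin 1ℤ (- + i)) ⟨
  Π n (λ i → lin 1ℤ (- + i)) ⊛ lin 1ℤ (- + n)
    ≈⟨ ⊛-congʳ (lin 1ℤ (- + n)) (Π-cong n λ i → ≋-trans (lin-neg 1ℤ (+ i)) (⊛-congˡ (con (- 1ℤ)) (reflect-cong (≋-sym (factor-zero 1ℤ i))))) ⟩
  Π n (λ i → con (- 1ℤ) ⊛ reflect (factor 1ℤ 0ℤ i)) ⊛ lin 1ℤ (- + n)
    ≈⟨ ⊛-congʳ (lin 1ℤ (- + n)) (≋-trans (Π-⊛ n (λ _ → con (- 1ℤ)) (λ i → reflect (factor 1ℤ 0ℤ i)))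
         (⊛-cong (Π-con n (- 1ℤ)) (≋-sym (reflect-Π n (factor 1ℤ 0ℤ))))) ⟩
  con ((- 1ℤ) ^ᶻ n) ⊛ reflect (P zero n 0ℤ) ⊛ lin 1ℤ (- + n)
    ≈⟨ rearrange (con ((- 1ℤ) ^ᶻ n)) (reflect (P zero n 0ℤ)) (lin 1ℤ (- + n)) ⟩
  con ((- 1ℤ) ^ᶻ n) ⊛ (lin 1ℤ (- + n) ⊛ reflect (P zero n 0ℤ)) ∎
  where
  open ≋-Reasoning
  lemma : ∀ i n → i + 1ℤ * (- n) ≡ i - n
  lemma = solve-∀
  reflect-cong : ∀ {f g} → f ≋ g → reflect f ≋ reflect g
  reflect-cong p = coeffwise λ n → cong ((- 1ℤ) ^ᶻ n *_) (coeff p n)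
  Y-lin : Y ≋ lin 1ℤ 0ℤ
  Y-lin = ≋-sym (≋-trans (CommutativeRing.+-identityˡ seriesRing _) (⊛-identityˡ Y))
  rearrange : ∀ x y z → x ⊛ y ⊛ z ≋ x ⊛ (z ⊛ y)
  rearrange = solve 3 (λ x y z → x :* y :* z := x :* (z :* y)) ≋-refl
P-reflect (suc e) n = begin
  Y ⊛ (P e n (- + n) ⊛ Π b (pair α (- + n)))
    ≈⟨ ⊛-assoc Y (P e n (- + n)) (Π b (pair α (- + n))) ⟨
  (Y ⊛ P e n (- + n)) ⊛ Π b (pair α (- + n))
    ≈⟨ ⊛-cong (P-reflect e n) (≋-trans (Π-cong b to-ψ) (≋-trans (Π-reverse b ψ) (≋-trans (Π-cong b from-ψ) (≋-sym (reflect-Π b (pair α 0ℤ)))))) ⟩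
  (con ((- 1ℤ) ^ᶻ n) ⊛ (lin 1ℤ (- + n) ⊛ reflect (P e n 0ℤ))) ⊛ reflect (Π b (pair α 0ℤ))
    ≈⟨ rearrange (con ((- 1ℤ) ^ᶻ n)) (lin 1ℤ (- + n)) (reflect (P e n 0ℤ)) (reflect (Π b (pair α 0ℤ))) ⟩
  con ((- 1ℤ) ^ᶻ n) ⊛ (lin 1ℤ (- + n) ⊛ (reflect (P e n 0ℤ) ⊛ reflect (Π b (pair α 0ℤ))))
    ≈⟨ ⊛-congˡ (con ((- 1ℤ) ^ᶻ n)) (⊛-congˡ (lin 1ℤ (- + n)) (≋-sym (reflect-⊛ (P e n 0ℤ) (Π b (pair α 0ℤ))))) ⟩
  con ((- 1ℤ) ^ᶻ n) ⊛ (lin 1ℤ (- + n) ⊛ reflect (P (suc e) n 0ℤ)) ∎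
  where
  open ≋-Reasoning
  b = block e n
  α = (+ 3) ^ᶻ suc e
  ψ : ℤ → Series
  ψ z = lin α (1ℤ + z * + 3) ⊛ lin α (+ 2 + z * + 3)
  rearrange : ∀ x y z w → (x ⊛ (y ⊛ z)) ⊛ w ≋ x ⊛ (y ⊛ (z ⊛ w))
  rearrange = solve 4 (λ x y z w → (x :* (y :* z)) :* w := x :* (y :* (z :* w))) ≋-refl
  shift : ∀ i j p n → i + j * + 3 + + 3 * p * (- n) ≡ i + (j - p * n) * + 3
  shift = solve-∀
  shifted : ∀ i j → factor α (- + n) (i ℕ.+ j ℕ.* 3) ≋ lin α (+ i + (+ j - + b) * + 3)
  shifted i j = lin-cong refl (trans (cong (λ z → + i + z + α * (- + n)) (ℤ.pos-* j 3))
    (trans (shift (+ i) (+ j) ((+ 3) ^ᶻ e) (+ n)) (cong (λ z → + i + (+ j - z) * + 3) (sym (block-pos e n)))))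
  to-ψ : ∀ j → pair α (- + n) j ≋ ψ (+ j - + b)
  to-ψ j = ⊛-cong (shifted 1 j) (shifted 2 j)
  -- Reversal exchanges the residues 1 and 2 modulo 3, so it maps each pair to a pair, and the two
  -- signs within a pair cancel. This is why the sign stays (-1)^n at every level.
  negate₁ : ∀ j → 1ℤ + (- (1ℤ + j)) * + 3 ≡ - (+ 2 + j * + 3)
  negate₁ = solve-∀
  negate₂ : ∀ j → + 2 + (- (1ℤ + j)) * + 3 ≡ - (1ℤ + j * + 3)
  negate₂ = solve-∀
  as-factor : ∀ i j → + i + + j * + 3 ≡ + (i ℕ.+ j ℕ.* 3) + α * 0ℤ
  as-factor i j = trans (cong (_+_ (+ i)) (sym (ℤ.pos-* j 3))) (sym (trans (cong (_+_ (+ (i ℕ.+ j ℕ.* 3))) (ℤ.*-zeroʳ α)) (ℤ.+-identityʳ _)))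
  square : ∀ f g → (con (- 1ℤ) ⊛ f) ⊛ (con (- 1ℤ) ⊛ g) ≋ g ⊛ f
  square f g = ≋-trans (collect (con (- 1ℤ)) f g)
    (≋-trans (⊛-congʳ (g ⊛ f) (≋-sym (con-* (- 1ℤ) (- 1ℤ)))) (⊛-identityˡ (g ⊛ f)))
    where
    collect : ∀ m f g → (m ⊛ f) ⊛ (m ⊛ g) ≋ (m ⊛ m) ⊛ (g ⊛ f)
    collect = solve 3 (λ m f g → (m :* f) :* (m :* g) := (m :* m) :* (g :* f)) ≋-refl
  from-ψ : ∀ j → ψ (- + suc j) ≋ reflect (pair α 0ℤ j)
  from-ψ j = begin
    ψ (- + suc j)
      ≈⟨ ⊛-cong (lin-cong refl (trans (negate₁ (+ j)) (cong -_ (as-factor 2 j))))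
                (lin-cong refl (trans (negate₂ (+ j)) (cong -_ (as-factor 1 j)))) ⟩
    lin α (- (+ (2 ℕ.+ j ℕ.* 3) + α * 0ℤ)) ⊛ lin α (- (+ (1 ℕ.+ j ℕ.* 3) + α * 0ℤ))
      ≈⟨ ⊛-cong (lin-neg α _) (lin-neg α _) ⟩
    (con (- 1ℤ) ⊛ reflect (factor α 0ℤ (2 ℕ.+ j ℕ.* 3))) ⊛ (con (- 1ℤ) ⊛ reflect (factor α 0ℤ (1 ℕ.+ j ℕ.* 3)))
      ≈⟨ square _ _ ⟩
    reflect (factor α 0ℤ (1 ℕ.+ j ℕ.* 3)) ⊛ reflect (factor α 0ℤ (2 ℕ.+ j ℕ.* 3))
      ≈⟨ reflect-⊛ (factor α 0ℤ (1 ℕ.+ j ℕ.* 3)) (factor α 0ℤ (2 ℕ.+ j ℕ.* 3)) ⟨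
    reflect (pair α 0ℤ j) ∎

-- Congruences for `P` modulo powers of 3.

record Congruent (d : ℤ) (f g : Series) : Set where
  constructor by-quotient
  field
    quotient : Series
    equation : f ≋ g ⊕ con d ⊛ quotient
open Congruent public

Congruent-reflexive : ∀ {d f g} → f ≋ g → Congruent d f g
Congruent-reflexive {d} {f} {g} p = by-quotient (con 0ℤ) (≋-trans p (rearrange g (con d)))
  where
  rearrange : ∀ g d → g ≋ g ⊕ d ⊛ con 0ℤ
  rearrange = solve 2 (λ g d → g := g :+ d :* :con 0) ≋-refl

Congruent-trans : ∀ {d f g h} → Congruent d f g → Congruent d g h → Congruent d f h
Congruent-trans {d} {h = h} (by-quotient q p) (by-quotient q′ p′) = by-quotient (q′ ⊕ q)
  (≋-trans p (≋-trans (⊕-cong p′ ≋-refl) (rearrange h (con d) q′ q)))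
  where
  rearrange : ∀ h d x y → (h ⊕ d ⊛ x) ⊕ d ⊛ y ≋ h ⊕ d ⊛ (x ⊕ y)
  rearrange = solve 4 (λ h d x y → (h :+ d :* x) :+ d :* y := h :+ d :* (x :+ y)) ≋-refl

Congruent-⊛ : ∀ {d f g f′ g′} → Congruent d f g → Congruent d f′ g′ → Congruent d (f ⊛ f′) (g ⊛ g′)
Congruent-⊛ {d} {g = g} {g′ = g′} (by-quotient q p) (by-quotient q′ p′) = by-quotient (q ⊛ g′ ⊕ g ⊛ q′ ⊕ con d ⊛ q ⊛ q′)
  (≋-trans (⊛-cong p p′) (rearrange (con d) g q g′ q′))
  where
  rearrange : ∀ d g q g′ q′ → (g ⊕ d ⊛ q) ⊛ (g′ ⊕ d ⊛ q′) ≋ g ⊛ g′ ⊕ d ⊛ (q ⊛ g′ ⊕ g ⊛ q′ ⊕ d ⊛ q ⊛ q′)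
  rearrange = solve 5 (λ d g q g′ q′ →
    (g :+ d :* q) :* (g′ :+ d :* q′) := g :* g′ :+ d :* (q :* g′ :+ g :* q′ :+ d :* q :* q′)) ≋-refl

Congruent-Π : ∀ {d} n {φ ψ} → (∀ i → Congruent d (φ i) (ψ i)) → Congruent d (Π n φ) (Π n ψ)
Congruent-Π zero    c = Congruent-reflexive ≋-refl
Congruent-Π (suc n) c = Congruent-⊛ (Congruent-Π n c) (c n)

Congruent-coeff : ∀ {d f g} → Congruent d f g → ∀ n → ∃ λ w → f n ≡ g n + d * w
Congruent-coeff {d} {g = g} (by-quotient q p) n = q n , trans (coeff p n) (cong (_+_ (g n)) (con-⊛ d q n))

-- The form in which the ring solver evaluates its numerals: sums of the unit series, equal to
-- `con (+ 2)` and `con (+ 3)` only up to `≋`.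
two three : Series
two   = con 1ℤ ⊕ con 1ℤ
three = two ⊕ con 1ℤ

con-2 : con (+ 2) ≋ two
con-2 = con-+ 1ℤ 1ℤ

con-3 : con (+ 3) ≋ three
con-3 = ≋-trans (con-+ (+ 2) 1ℤ) (⊕-cong con-2 ≋-refl)

-- `f₁` and `f₂` are the translates of `f` by h and 2h, where h = 3pq. In f f₁ f₂ the first-order
-- terms add up to 3h f² Df and the others contain h²; all are multiples of 9p, so f³ remains. In (g
-- + 3pw)³ every term except g³ is a multiple of 9p as well.
cubing : ∀ {f f₁ f₂ g} p q → Congruent (+ 3 * p) f g →
  Expansion (+ 3 * p * q) f f₁ → Expansion (+ 3 * p * q + + 3 * p * q) f f₂ →
  Congruent (+ 3 * (+ 3 * p)) (f ⊛ (f₁ ⊛ f₂)) (g ⊛ (g ⊛ g))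
cubing {f} {f₁} {f₂} {g} p q (by-quotient w f≡g) E₁ E₂ = Congruent-trans
  (by-quotient _ (≋-trans (⊛-congˡ f (⊛-cong (≋-trans (expansion E₁) expand₁) (≋-trans (expansion E₂) expand₂)))
    (≋-trans (shifts f (con p) (con q) (D f) z₁ z₂) (⊕-cong (≋-refl {f ⊛ (f ⊛ f)}) (⊛-congʳ _ (≋-sym nine))))))
  (by-quotient _ (≋-trans (⊛-cong f≡g′ (⊛-cong f≡g′ f≡g′))
    (≋-trans (cubes g (con p) w) (⊕-cong (≋-refl {g ⊛ (g ⊛ g)}) (⊛-congʳ _ (≋-sym nine))))))
  where
  h₁ = + 3 * p * q
  z₁ = second E₁ ⊕ con h₁ ⊛ remainder E₁
  z₂ = second E₂ ⊕ con (h₁ + h₁) ⊛ remainder E₂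
  three-p : con (+ 3 * p) ≋ three ⊛ con p
  three-p = ≋-trans (con-* (+ 3) p) (⊛-congʳ (con p) con-3)
  nine : con (+ 3 * (+ 3 * p)) ≋ three ⊛ (three ⊛ con p)
  nine = ≋-trans (con-* (+ 3) (+ 3 * p)) (⊛-cong con-3 three-p)
  con-h₁ : con h₁ ≋ three ⊛ con p ⊛ con q
  con-h₁ = ≋-trans (con-* (+ 3 * p) q) (⊛-congʳ (con q) three-p)
  con-h₂ : con (h₁ + h₁) ≋ three ⊛ con p ⊛ con q ⊕ three ⊛ con p ⊛ con q
  con-h₂ = ≋-trans (con-+ h₁ h₁) (⊕-cong con-h₁ con-h₁)
  f≡g′ : f ≋ g ⊕ three ⊛ con p ⊛ w
  f≡g′ = ≋-trans f≡g (⊕-cong (≋-refl {g}) (⊛-congʳ w three-p))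
  factor-out : ∀ f h d s r → f ⊕ h ⊛ d ⊕ h ⊛ h ⊛ s ⊕ h ⊛ h ⊛ h ⊛ r ≋ f ⊕ h ⊛ d ⊕ h ⊛ h ⊛ (s ⊕ h ⊛ r)
  factor-out = solve 5 (λ f h d s r →
    f :+ h :* d :+ h :* h :* s :+ h :* h :* h :* r := f :+ h :* d :+ h :* h :* (s :+ h :* r)) ≋-refl
  substitute : ∀ {h h′} → h ≋ h′ → ∀ d z → f ⊕ h ⊛ d ⊕ h ⊛ h ⊛ z ≋ f ⊕ h′ ⊛ d ⊕ h′ ⊛ h′ ⊛ z
  substitute p d z = ⊕-cong (⊕-cong (≋-refl {f}) (⊛-congʳ d p)) (⊛-congʳ z (⊛-cong p p))
  expand₁ = ≋-trans (factor-out f (con h₁) (D f) (second E₁) (remainder E₁)) (substitute con-h₁ (D f) z₁)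
  expand₂ = ≋-trans (factor-out f (con (h₁ + h₁)) (D f) (second E₂) (remainder E₂)) (substitute con-h₂ (D f) z₂)
  shifts : ∀ f p q d z z′ → let h = three ⊛ p ⊛ q in
    f ⊛ ((f ⊕ h ⊛ d ⊕ h ⊛ h ⊛ z) ⊛ (f ⊕ (h ⊕ h) ⊛ d ⊕ (h ⊕ h) ⊛ (h ⊕ h) ⊛ z′)) ≋
    f ⊛ (f ⊛ f) ⊕ three ⊛ (three ⊛ p) ⊛
      (q ⊛ (f ⊛ f ⊛ d) ⊕ p ⊛ q ⊛ q ⊛ (f ⊛ f ⊛ (z ⊕ two ⊛ two ⊛ z′) ⊕ f ⊛ (d ⊕ h ⊛ z) ⊛ (two ⊛ d ⊕ two ⊛ two ⊛ h ⊛ z′)))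
  shifts = solve 6 (λ f p q d z z′ → let h = :con 3 :* p :* q in
    f :* ((f :+ h :* d :+ h :* h :* z) :* (f :+ (h :+ h) :* d :+ (h :+ h) :* (h :+ h) :* z′)) :=
    f :* (f :* f) :+ :con 3 :* (:con 3 :* p) :*
      (q :* (f :* f :* d) :+ p :* q :* q :* (f :* f :* (z :+ :con 2 :* :con 2 :* z′)
        :+ f :* (d :+ h :* z) :* (:con 2 :* d :+ :con 2 :* :con 2 :* h :* z′)))) ≋-refl
  cubes : ∀ g p w → (g ⊕ three ⊛ p ⊛ w) ⊛ ((g ⊕ three ⊛ p ⊛ w) ⊛ (g ⊕ three ⊛ p ⊛ w)) ≋
    g ⊛ (g ⊛ g) ⊕ three ⊛ (three ⊛ p) ⊛ (g ⊛ g ⊛ w ⊕ three ⊛ p ⊛ (g ⊛ w ⊛ w) ⊕ three ⊛ p ⊛ p ⊛ (w ⊛ w ⊛ w))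
  cubes = solve 3 (λ g p w → (g :+ :con 3 :* p :* w) :* ((g :+ :con 3 :* p :* w) :* (g :+ :con 3 :* p :* w)) :=
    g :* (g :* g) :+ :con 3 :* (:con 3 :* p) :*
      (g :* g :* w :+ :con 3 :* p :* (g :* w :* w) :+ :con 3 :* p :* p :* (w :* w :* w))) ≋-refl

factor-periodic : ∀ α i j → Congruent (+ 3) (factor α 0ℤ (i ℕ.+ j ℕ.* 3)) (lin α (+ i))
factor-periodic α i j = by-quotient (con (+ j)) (≋-trans
  (lin-cong refl (trans (cong (_+_ (+ (i ℕ.+ j ℕ.* 3))) (ℤ.*-zeroʳ α)) (trans (ℤ.+-identityʳ _) (cong (_+_ (+ i)) (ℤ.pos-* j 3)))))
  (≋-trans (⊕-cong (≋-trans (con-+ (+ i) (+ j * + 3)) (⊕-cong (≋-refl {con (+ i)}) (con-* (+ j) (+ 3)))) ≋-refl)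
    (rearrange (con (+ i)) (con (+ j)) (con (+ 3)) (con α ⊛ Y))))
  where
  rearrange : ∀ i j t y → i ⊕ j ⊛ t ⊕ y ≋ i ⊕ y ⊕ t ⊛ j
  rearrange = solve 4 (λ i j t y → i :+ j :* t :+ y := i :+ y :+ t :* j) ≋-refl

lin-3-mod-3 : ∀ α i → Congruent (+ 3) (lin (+ 3 * α) i) (con i)
lin-3-mod-3 α i = by-quotient (con α ⊛ Y)
  (⊕-cong (≋-refl {con i}) (≋-trans (⊛-congʳ Y (con-* (+ 3) α)) (⊛-assoc (con (+ 3)) (con α) Y)))

-- y² + 2 ≡ y² − 1 modulo 3
quadratic : Series
quadratic = con (+ 2) ⊕ Y ⊛ Y

-- y (y + 1) (y + 2) = y (y² + 2) + 3 y².
three-factors : Congruent (+ 3) (lin 1ℤ 0ℤ ⊛ (lin 1ℤ 1ℤ ⊛ lin 1ℤ (+ 2))) (Y ⊛ quadratic)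
three-factors = by-quotient (Y ⊛ Y) (≋-trans
  (⊛-congˡ (lin 1ℤ 0ℤ) (⊛-congˡ (lin 1ℤ 1ℤ) (⊕-cong con-2 ≋-refl)))
  (≋-trans (rearrange Y)
    (⊕-cong (⊛-congˡ Y (⊕-cong (≋-sym con-2) ≋-refl)) (⊛-congʳ (Y ⊛ Y) (≋-sym con-3)))))
  where
  rearrange : ∀ y → (con 0ℤ ⊕ con 1ℤ ⊛ y) ⊛ ((con 1ℤ ⊕ con 1ℤ ⊛ y) ⊛ (two ⊕ con 1ℤ ⊛ y)) ≋
    y ⊛ (two ⊕ y ⊛ y) ⊕ three ⊛ (y ⊛ y)
  rearrange = solve 1 (λ y → (:con 0 :+ :con 1 :* y) :* ((:con 1 :+ :con 1 :* y) :* (:con 2 :+ :con 1 :* y)) :=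
    y :* (:con 2 :+ y :* y) :+ :con 3 :* (y :* y)) ≋-refl

-- Level 0 consists of triples of consecutive factors. Each further level adds pairs whose y-terms
-- are multiples of 3, hence constants 1 · 2 modulo 3. The exponent of 2 is left existential: it
-- matters only that the power is a unit.
P-mod-3 : ∀ e n → ∃ λ j → Congruent (+ 3) (P e (n ℕ.* 3) 0ℤ) (con ((+ 2) ^ᶻ j) ⊛ Π n (λ _ → Y ⊛ quadratic))
P-mod-3 zero    n = 0 , Congruent-trans (Congruent-reflexive (Π-triples n (factor 1ℤ 0ℤ)))
  (Congruent-trans
    (Congruent-Π n λ j → Congruent-trans
      (Congruent-⊛ (factor-periodic 1ℤ 0 j) (Congruent-⊛ (factor-periodic 1ℤ 1 j) (factor-periodic 1ℤ 2 j)))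
      three-factors)
    (Congruent-reflexive (≋-sym (⊛-identityˡ _))))
P-mod-3 (suc e) n with P-mod-3 e n
... | j , P≡ = j ℕ.+ b , Congruent-trans
  (Congruent-⊛ P≡ (Congruent-trans (Congruent-Π b pair-mod-3) (Congruent-reflexive (Π-con b (+ 2)))))
  (Congruent-reflexive (≋-trans (rearrange (con ((+ 2) ^ᶻ j)) _ (con ((+ 2) ^ᶻ b)))
    (⊛-congʳ _ (≋-sym (≋-trans (con-cong (ℤ.^-distribˡ-+-* (+ 2) j b)) (con-* ((+ 2) ^ᶻ j) ((+ 2) ^ᶻ b)))))))
  where
  b = block e (n ℕ.* 3)
  rearrange : ∀ x f y → (x ⊛ f) ⊛ y ≋ (x ⊛ y) ⊛ f
  rearrange = solve 3 (λ x f y → (x :* f) :* y := (x :* y) :* f) ≋-refl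
  pair-mod-3 : ∀ i → Congruent (+ 3) (pair ((+ 3) ^ᶻ suc e) 0ℤ i) (con (+ 2))
  pair-mod-3 i = Congruent-trans
    (Congruent-⊛ (Congruent-trans (factor-periodic ((+ 3) ^ᶻ suc e) 1 i) (lin-3-mod-3 ((+ 3) ^ᶻ e) 1ℤ))
                 (Congruent-trans (factor-periodic ((+ 3) ^ᶻ suc e) 2 i) (lin-3-mod-3 ((+ 3) ^ᶻ e) (+ 2))))
    (Congruent-reflexive (⊛-identityˡ (con (+ 2))))

thrice : ∀ n → n ℕ.* 3 ≡ n ℕ.+ (n ℕ.+ n)
thrice = ℕ-Solver.solve-∀

P-mod-3^ : ∀ e a r → ∃ λ j →
  Congruent ((+ 3) ^ᶻ suc r) (P e (block (suc r) a) 0ℤ) (con ((+ 2) ^ᶻ j) ⊛ Π (block r a) (λ _ → Y ⊛ quadratic))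
P-mod-3^ e a zero    = P-mod-3 e a
P-mod-3^ e a (suc r) with P-mod-3^ e a r
... | j , P≡ = j ℕ.+ (j ℕ.+ j) , Congruent-trans
  (Congruent-reflexive split)
  (Congruent-trans
    -- The translation n = 3^(r+1) a is a multiple of the modulus 3^(r+1) reached so far.
    (cubing ((+ 3) ^ᶻ r) (+ a) P≡ (shifted n n-pos) (shifted (n ℕ.+ n) (cong₂ _+_ n-pos n-pos)))
    (Congruent-reflexive (≋-trans (rearrange (con ((+ 2) ^ᶻ j)) (Π t λ _ → Y ⊛ quadratic)) (⊛-cong powers (≋-sym product)))))
  where
  n = block (suc r) a
  t = block r a
  n-pos : + n ≡ + 3 * (+ 3) ^ᶻ r * + a
  n-pos = block-pos (suc r) a
  shifted : ∀ m {h} → + m ≡ h → Expansion h (P e n 0ℤ) (P e n (0ℤ + + m))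
  shifted m refl = P-Expansion (+ m) e n 0ℤ
  split : P e (n ℕ.* 3) 0ℤ ≋ P e n 0ℤ ⊛ (P e n (0ℤ + + n) ⊛ P e n (0ℤ + + (n ℕ.+ n)))
  split = subst (λ k → P e k 0ℤ ≋ P e n 0ℤ ⊛ (P e n (0ℤ + + n) ⊛ P e n (0ℤ + + (n ℕ.+ n)))) (sym (thrice n))
    (≋-trans (P-+ e n (n ℕ.+ n) 0ℤ) (⊛-congˡ (P e n 0ℤ) (P-+ e n n (0ℤ + + n))))
  product : Π (t ℕ.* 3) (λ _ → Y ⊛ quadratic) ≋
    Π t (λ _ → Y ⊛ quadratic) ⊛ (Π t (λ _ → Y ⊛ quadratic) ⊛ Π t (λ _ → Y ⊛ quadratic))
  product = ≋-trans
    (≋-trans (Π-triples t (λ _ → Y ⊛ quadratic)) (Π-⊛ t (λ _ → Y ⊛ quadratic) (λ _ → (Y ⊛ quadratic) ⊛ (Y ⊛ quadratic))))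
    (⊛-congˡ (Π t λ _ → Y ⊛ quadratic) (Π-⊛ t (λ _ → Y ⊛ quadratic) (λ _ → Y ⊛ quadratic)))
  powers : con ((+ 2) ^ᶻ j) ⊛ (con ((+ 2) ^ᶻ j) ⊛ con ((+ 2) ^ᶻ j)) ≋ con ((+ 2) ^ᶻ (j ℕ.+ (j ℕ.+ j)))
  powers = ≋-sym (≋-trans (con-cong (trans (ℤ.^-distribˡ-+-* (+ 2) j (j ℕ.+ j)) (cong (_*_ ((+ 2) ^ᶻ j)) (ℤ.^-distribˡ-+-* (+ 2) j j))))
    (≋-trans (con-* ((+ 2) ^ᶻ j) _) (⊛-congˡ (con ((+ 2) ^ᶻ j)) (con-* ((+ 2) ^ᶻ j) ((+ 2) ^ᶻ j)))))
  rearrange : ∀ x f → (x ⊛ f) ⊛ ((x ⊛ f) ⊛ (x ⊛ f)) ≋ (x ⊛ (x ⊛ x)) ⊛ (f ⊛ (f ⊛ f))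
  rearrange = solve 2 (λ x f → (x :* f) :* ((x :* f) :* (x :* f)) := (x :* (x :* x)) :* (f :* (f :* f))) ≋-refl

-- Coefficients of (y (y² + 2))^T and their transfer to `P`.

Π-Y-coeff : ∀ t f n → (Π t (λ _ → Y) ⊛ f) (t ℕ.+ n) ≡ f n
Π-Y-coeff zero    f n = coeff (⊛-identityˡ f) n
Π-Y-coeff (suc t) f n = trans (coeff (rearrange (Π t λ _ → Y) Y f) (suc t ℕ.+ n))
  (trans (Y-⊛-suc (Π t (λ _ → Y) ⊛ f) (t ℕ.+ n)) (Π-Y-coeff t f n))
  where
  rearrange : ∀ p y f → (p ⊛ y) ⊛ f ≋ y ⊛ (p ⊛ f)
  rearrange = solve 3 (λ p y f → (p :* y) :* f := y :* (p :* f)) ≋-refl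

⊛-quadratic : ∀ f → f ⊛ quadratic ≋ con (+ 2) ⊛ f ⊕ Y ⊛ (Y ⊛ f)
⊛-quadratic f = rearrange f (con (+ 2)) Y
  where
  rearrange : ∀ f c y → f ⊛ (c ⊕ y ⊛ y) ≋ c ⊛ f ⊕ y ⊛ (y ⊛ f)
  rearrange = solve 3 (λ f c y → f :* (c :+ y :* y) := c :* f :+ y :* (y :* f)) ≋-refl

⊛-quadratic-0 : ∀ f → (f ⊛ quadratic) 0 ≡ + 2 * f 0
⊛-quadratic-0 f = trans (coeff (⊛-quadratic f) 0) (ℤ.+-identityʳ _)

⊛-quadratic-1 : ∀ f → (f ⊛ quadratic) 1 ≡ + 2 * f 1
⊛-quadratic-1 f = trans (coeff (⊛-quadratic f) 1)
  (trans (cong₂ _+_ (con-⊛ (+ 2) f 1) (Y-⊛-suc (Y ⊛ f) 0)) (ℤ.+-identityʳ _))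

⊛-quadratic-suc-suc : ∀ f n → (f ⊛ quadratic) (suc (suc n)) ≡ + 2 * f (suc (suc n)) + f n
⊛-quadratic-suc-suc f n = trans (coeff (⊛-quadratic f) (suc (suc n)))
  (cong₂ _+_ (con-⊛ (+ 2) f (suc (suc n))) (trans (Y-⊛-suc (Y ⊛ f) (suc n)) (Y-⊛-suc f n)))

-- A power of 2 + y² is a polynomial in y².
quadratic-power-odd : ∀ t s → Π t (λ _ → quadratic) (1 ℕ.+ s ℕ.* 2) ≡ 0ℤ
quadratic-power-odd zero    s       = refl
quadratic-power-odd (suc t) zero    =
  trans (⊛-quadratic-1 (Π t λ _ → quadratic)) (cong (+ 2 *_) (quadratic-power-odd t 0))
quadratic-power-odd (suc t) (suc s) = trans (⊛-quadratic-suc-suc (Π t λ _ → quadratic) (1 ℕ.+ s ℕ.* 2))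
  (cong₂ (λ x y → + 2 * x + y) (quadratic-power-odd t (suc s)) (quadratic-power-odd t s))

-- The binomial theorem for (2 + y²)^t, by Pascal's rule.
quadratic-power-even : ∀ t s → Π t (λ _ → quadratic) (s ℕ.* 2) ≡ (+ 2) ^ᶻ (t ℕ.∸ s) * + (t C s)
quadratic-power-even zero    zero    = refl
quadratic-power-even zero    (suc s) = sym (cong (_*_ 1ℤ) (cong +_ (k>n⇒nCk≡0 {zero} {suc s} (ℕ.s≤s ℕ.z≤n))))
quadratic-power-even (suc t) zero    = trans (⊛-quadratic-0 (Π t λ _ → quadratic))
  (trans (cong (+ 2 *_) (quadratic-power-even t 0)) (sym (ℤ.*-assoc (+ 2) ((+ 2) ^ᶻ t) (+ 1))))
quadratic-power-even (suc t) (suc s) = begin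
  (Π t (λ _ → quadratic) ⊛ quadratic) (suc (suc (s ℕ.* 2)))
    ≡⟨ ⊛-quadratic-suc-suc (Π t λ _ → quadratic) (s ℕ.* 2) ⟩
  + 2 * Π t (λ _ → quadratic) (suc s ℕ.* 2) + Π t (λ _ → quadratic) (s ℕ.* 2)
    ≡⟨ cong₂ (λ x y → + 2 * x + y) (quadratic-power-even t (suc s)) (quadratic-power-even t s) ⟩
  + 2 * ((+ 2) ^ᶻ (t ℕ.∸ suc s) * + (t C suc s)) + (+ 2) ^ᶻ (t ℕ.∸ s) * + (t C s)
    ≡⟨ cong (_+ (+ 2) ^ᶻ (t ℕ.∸ s) * + (t C s)) absorb ⟩
  (+ 2) ^ᶻ (t ℕ.∸ s) * + (t C suc s) + (+ 2) ^ᶻ (t ℕ.∸ s) * + (t C s)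
    ≡⟨ lemma ((+ 2) ^ᶻ (t ℕ.∸ s)) (+ (t C suc s)) (+ (t C s)) ⟩
  (+ 2) ^ᶻ (t ℕ.∸ s) * (+ (t C s) + + (t C suc s))
    ≡⟨ cong (λ c → (+ 2) ^ᶻ (t ℕ.∸ s) * + c) (nCk+nC[k+1]≡[n+1]C[k+1] t s) ⟩
  (+ 2) ^ᶻ (t ℕ.∸ s) * + (suc t C suc s) ∎
  where
  open ≡-Reasoning
  lemma : ∀ p x y → p * x + p * y ≡ p * (y + x)
  lemma = solve-∀
  -- For s ≥ t the truncated exponents no longer differ by one, but the binomial coefficient is then
  -- 0.
  absorb : + 2 * ((+ 2) ^ᶻ (t ℕ.∸ suc s) * + (t C suc s)) ≡ (+ 2) ^ᶻ (t ℕ.∸ s) * + (t C suc s)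
  absorb with suc s ℕ.≤? t
  ... | yes s<t = trans (sym (ℤ.*-assoc (+ 2) ((+ 2) ^ᶻ (t ℕ.∸ suc s)) (+ (t C suc s))))
    (cong (λ d → (+ 2) ^ᶻ d * + (t C suc s)) (sym (ℕ.+-∸-assoc 1 s<t)))
  ... | no  s≮t rewrite k>n⇒nCk≡0 (ℕ.≰⇒> s≮t) =
    trans (cong (+ 2 *_) (ℤ.*-zeroʳ ((+ 2) ^ᶻ (t ℕ.∸ suc s)))) (sym (ℤ.*-zeroʳ ((+ 2) ^ᶻ (t ℕ.∸ s))))

-- With r = m - 1, `block r a` is T and `block (suc r) a` is M. The index T + 2s with s = T - t is K
-- = M - 2t.
σ : ℕ → ℕ → ℕ → Series
σ e r a = P e (block (suc r) a) 0ℤ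

Π-Y-quadratic-coeff : ∀ t n → Π t (λ _ → Y ⊛ quadratic) (t ℕ.+ n) ≡ Π t (λ _ → quadratic) n
Π-Y-quadratic-coeff t n = trans (coeff (Π-⊛ t (λ _ → Y) (λ _ → quadratic)) (t ℕ.+ n))
  (Π-Y-coeff t (Π t λ _ → quadratic) n)

σ-mod-3^ : ∀ e r a → ∃ λ j → ∀ n → ∃ λ w →
  σ e r a (block r a ℕ.+ n) ≡ (+ 2) ^ᶻ j * Π (block r a) (λ _ → quadratic) n + (+ 3) ^ᶻ suc r * w
σ-mod-3^ e r a with P-mod-3^ e a r
... | j , P≡ = j , λ n → let w , eq = Congruent-coeff P≡ (block r a ℕ.+ n) in
  w , trans eq (cong (_+ (+ 3) ^ᶻ suc r * w)
        (trans (con-⊛ ((+ 2) ^ᶻ j) _ (block r a ℕ.+ n)) (cong ((+ 2) ^ᶻ j *_) (Π-Y-quadratic-coeff (block r a) n))))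

σ-even : ∀ e r a s → ∃ λ j → ∃ λ w → σ e r a (block r a ℕ.+ s ℕ.* 2) ≡ (+ 2) ^ᶻ j * + (block r a C s) + (+ 3) ^ᶻ suc r * w
σ-even e r a s with σ-mod-3^ e r a
... | j , congruence with congruence (s ℕ.* 2)
... | w , eq = j ℕ.+ (block r a ℕ.∸ s) , w , trans eq (cong (_+ (+ 3) ^ᶻ suc r * w)
  (trans (cong ((+ 2) ^ᶻ j *_) (quadratic-power-even (block r a) s))
    (trans (sym (ℤ.*-assoc ((+ 2) ^ᶻ j) _ (+ (block r a C s))))
      (cong (_* + (block r a C s)) (sym (ℤ.^-distribˡ-+-* (+ 2) j (block r a ℕ.∸ s)))))))

σ-odd : ∀ e r a s → ∃ λ w → σ e r a (block r a ℕ.+ (1 ℕ.+ s ℕ.* 2)) ≡ (+ 3) ^ᶻ suc r * w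
σ-odd e r a s with σ-mod-3^ e r a
... | j , congruence with congruence (1 ℕ.+ s ℕ.* 2)
... | w , eq = w , trans eq (trans (cong (λ z → (+ 2) ^ᶻ j * z + (+ 3) ^ᶻ suc r * w) (quadratic-power-odd (block r a) s))
  (trans (cong (_+ (+ 3) ^ᶻ suc r * w) (ℤ.*-zeroʳ ((+ 2) ^ᶻ j))) (ℤ.+-identityˡ _)))

-- Both sides are the k-th coefficient of the product of 3^e y + i over i < 3^e n.
σ-stirling1 : ∀ e n k → (+ 3) ^ᶻ content-exponent e n * P e n 0ℤ k ≡ ((+ 3) ^ᶻ e) ^ᶻ k * + stirling1 (block e n) k
σ-stirling1 e n k = trans (sym (con-⊛ ((+ 3) ^ᶻ content-exponent e n) (P e n 0ℤ) k))
  (trans (sym (coeff (P-scaled e n) k)) (Π-lin-coeff ((+ 3) ^ᶻ e) (block e n) k))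

-- The recurrence from the symmetry of `P`.

sign-square : ∀ k → (- 1ℤ) ^ᶻ k * (- 1ℤ) ^ᶻ k ≡ 1ℤ
sign-square zero    = refl
sign-square (suc k) = trans (lemma ((- 1ℤ) ^ᶻ k)) (sign-square k)
  where
  lemma : ∀ p → (- 1ℤ * p) * (- 1ℤ * p) ≡ p * p
  lemma = solve-∀

sign-odd : ∀ k t → (- 1ℤ) ^ᶻ (k ℕ.+ (1 ℕ.+ t ℕ.* 2)) ≡ - (- 1ℤ) ^ᶻ k
sign-odd k t = begin
  (- 1ℤ) ^ᶻ (k ℕ.+ (1 ℕ.+ t ℕ.* 2))             ≡⟨ ℤ.^-distribˡ-+-* (- 1ℤ) k (1 ℕ.+ t ℕ.* 2) ⟩
  (- 1ℤ) ^ᶻ k * (- 1ℤ * (- 1ℤ) ^ᶻ (t ℕ.* 2))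
    ≡⟨ cong (λ z → (- 1ℤ) ^ᶻ k * (- 1ℤ * z)) (trans (sym (ℤ.^-*-assoc (- 1ℤ) t 2)) (trans (lemma₁ ((- 1ℤ) ^ᶻ t)) (sign-square t))) ⟩
  (- 1ℤ) ^ᶻ k * (- 1ℤ * 1ℤ)                     ≡⟨ lemma₂ ((- 1ℤ) ^ᶻ k) ⟩
  - (- 1ℤ) ^ᶻ k                                 ∎
  where
  open ≡-Reasoning
  lemma₁ : ∀ p → p * (p * 1ℤ) ≡ p * p
  lemma₁ = solve-∀
  lemma₂ : ∀ p → p * (- 1ℤ * 1ℤ) ≡ - p
  lemma₂ = solve-∀

-- Doubled so that the second Taylor coefficient can be read off from D (D p).
odd-recurrence : ∀ e n k t → k ℕ.+ (1 ℕ.+ t ℕ.* 2) ≡ n → let p = P e n 0ℤ in ∃ λ x →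
  + 4 * p k ≡ + 2 * (+ n * + k * p (suc k)) - + n * + n * (+ suc k * (+ suc (suc k) * p (suc (suc k)))) + + n * + n * + n * x
odd-recurrence e n k t k+odd≡n = + 2 * ρ k , (begin
  + 4 * p k
    ≡⟨ eliminate (p k) (+ n) (+ k) (p (suc k)) (s k) (ρ k) (trans (sym taylor) reflected) ⟩
  + 2 * (+ n * + k * p (suc k)) - + n * + n * (+ 2 * s k) + + n * + n * + n * (+ 2 * ρ k)
    ≡⟨ cong (λ z → + 2 * (+ n * + k * p (suc k)) - + n * + n * z + + n * + n * + n * (+ 2 * ρ k))
         (trans (sym (con-⊛ (+ 2) s k)) (coeff (twice-second E) k)) ⟩
  + 2 * (+ n * + k * p (suc k)) - + n * + n * (+ suc k * (+ suc (suc k) * p (suc (suc k)))) + + n * + n * + n * (+ 2 * ρ k) ∎)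
  where
  open ≡-Reasoning
  p = P e n 0ℤ
  h = - + n
  E : Expansion h p (P e n h)
  E = subst (λ c → Expansion h p (P e n c)) (ℤ.+-identityˡ h) (P-Expansion h e n 0ℤ)
  s = second E
  ρ = remainder E
  taylor : P e n h k ≡ p k + h * (+ suc k * p (suc k)) + h * h * s k + h * h * h * ρ k
  taylor = trans (coeff (expansion E) k) (cong₂ _+_ (cong₂ _+_ (cong (_+_ (p k)) (con-⊛ h (D p) k))
    (trans (sym (coeff (⊛-congʳ s (con-* h h)) k)) (con-⊛ (h * h) s k)))
    (trans (sym (coeff (⊛-congʳ ρ (≋-trans (con-* (h * h) h) (⊛-congʳ (con h) (con-* h h)))) k)) (con-⊛ (h * h * h) ρ k)))
  rp = reflect p
  -- Since n - k is odd, `p k` has the sign opposite to that in `taylor`, so comparing the two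
  -- leaves 2 `p k`. For even n - k it would cancel.
  reflected : P e n h k ≡ - (p k + + n * p (suc k))
  reflected = begin
    P e n h k
      ≡⟨ Y-⊛-suc (P e n h) k ⟨
    (Y ⊛ P e n h) (suc k)
      ≡⟨ coeff (P-reflect e n) (suc k) ⟩
    (con ((- 1ℤ) ^ᶻ n) ⊛ (lin 1ℤ h ⊛ rp)) (suc k)
      ≡⟨ con-⊛ ((- 1ℤ) ^ᶻ n) (lin 1ℤ h ⊛ rp) (suc k) ⟩
    (- 1ℤ) ^ᶻ n * (lin 1ℤ h ⊛ rp) (suc k)
      ≡⟨ cong₂ _*_ (trans (cong ((- 1ℤ) ^ᶻ_) (sym k+odd≡n)) (sign-odd k t))
           (trans (coeff (⊛-comm (lin 1ℤ h) rp) (suc k)) (⊛-lin-suc rp 1ℤ h k)) ⟩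
    - (- 1ℤ) ^ᶻ k * (h * (- 1ℤ * (- 1ℤ) ^ᶻ k * p (suc k)) + 1ℤ * ((- 1ℤ) ^ᶻ k * p k))
      ≡⟨ collect ((- 1ℤ) ^ᶻ k) (+ n) (p k) (p (suc k)) ⟩
    ((- 1ℤ) ^ᶻ k * (- 1ℤ) ^ᶻ k) * - (p k + + n * p (suc k))
      ≡⟨ trans (cong (_* - (p k + + n * p (suc k))) (sign-square k)) (ℤ.*-identityˡ _) ⟩
    - (p k + + n * p (suc k)) ∎
    where
    collect : ∀ q n x y → - q * ((- n) * (- 1ℤ * q * y) + 1ℤ * (q * x)) ≡ (q * q) * - (x + n * y)
    collect = solve-∀
  eliminate : ∀ x n k y s r → x + (- n) * ((1ℤ + k) * y) + (- n) * (- n) * s + (- n) * (- n) * (- n) * r ≡ - (x + n * y) →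
    + 4 * x ≡ + 2 * (n * k * y) - n * n * (+ 2 * s) + n * n * n * (+ 2 * r)
  eliminate x n k y s r eq = trans (add-difference x n k y s r)
    (trans (cong (λ z → + 2 * (n * k * y) - n * n * (+ 2 * s) + n * n * n * (+ 2 * r) + + 2 * (z - - (x + n * y))) eq)
      (cancel _ (- (x + n * y))))
    where
    -- Twice the difference of the two sides of the hypothesis is inserted, which makes the claim a
    -- plain ring identity.
    add-difference : ∀ x n k y s r → + 4 * x ≡ + 2 * (n * k * y) - n * n * (+ 2 * s) + n * n * n * (+ 2 * r) +
      + 2 * (x + (- n) * ((1ℤ + k) * y) + (- n) * (- n) * s + (- n) * (- n) * (- n) * r - - (x + n * y))
    add-difference = solve-∀
    cancel : ∀ a b → a + + 2 * (b - b) ≡ a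
    cancel = solve-∀

-- Units modulo 3 and 3-adic valuations.

-- Being prime to 3 is witnessed by an inverse modulo 3, which turns closure under products and
-- under factors into computation.
record Unit₃ (u : ℤ) : Set where
  constructor unit-by
  field
    inverse quotient₃ : ℤ
    inverse-mod-3     : u * inverse ≡ 1ℤ + + 3 * quotient₃

Unit₃-* : ∀ {x y} → Unit₃ x → Unit₃ y → Unit₃ (x * y)
Unit₃-* {x} {y} (unit-by v w eq) (unit-by v′ w′ eq′) = unit-by (v * v′) (w + w′ + + 3 * (w * w′))
  (trans (interchange-ℤ x y v v′) (trans (cong₂ _*_ eq eq′) (expand w w′)))
  where
  interchange-ℤ : ∀ x y v v′ → x * y * (v * v′) ≡ (x * v) * (y * v′)
  interchange-ℤ = solve-∀
  expand : ∀ w w′ → (1ℤ + + 3 * w) * (1ℤ + + 3 * w′) ≡ 1ℤ + + 3 * (w + w′ + + 3 * (w * w′))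
  expand = solve-∀

Unit₃-factorʳ : ∀ x y → Unit₃ (x * y) → Unit₃ y
Unit₃-factorʳ x y (unit-by v w eq) = unit-by (x * v) w (trans (lemma x y v) eq)
  where
  lemma : ∀ x y v → y * (x * v) ≡ x * y * v
  lemma = solve-∀

Unit₃-+3* : ∀ {u} x → Unit₃ u → Unit₃ (u + + 3 * x)
Unit₃-+3* {u} x (unit-by v w eq) = unit-by v (w + x * v)
  (trans (expand u x v) (trans (cong (_+ + 3 * (x * v)) eq) (collect w x v)))
  where
  expand : ∀ u x v → (u + + 3 * x) * v ≡ u * v + + 3 * (x * v)
  expand = solve-∀
  collect : ∀ w x v → 1ℤ + + 3 * w + + 3 * (x * v) ≡ 1ℤ + + 3 * (w + x * v)
  collect = solve-∀

Unit₃-1 : Unit₃ 1ℤ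
Unit₃-1 = unit-by 1ℤ 0ℤ refl

Unit₃-2 : Unit₃ (+ 2)
Unit₃-2 = unit-by (+ 2) 1ℤ refl

Unit₃-2^ : ∀ n → Unit₃ ((+ 2) ^ᶻ n)
Unit₃-2^ zero    = Unit₃-1
Unit₃-2^ (suc n) = Unit₃-* Unit₃-2 (Unit₃-2^ n)

3*≢1 : ∀ x → ¬ + 3 * x ≡ 1ℤ
3*≢1 x eq = contradiction-ℕ ∣ x ∣ (trans (sym (ℤ.abs-* (+ 3) x)) (cong ∣_∣ eq))
  where
  contradiction-ℕ : ∀ n → ¬ 3 ℕ.* n ≡ 1
  contradiction-ℕ (suc n) eq with ℕ.suc-injective (trans (sym (ℕ.*-comm 3 (suc n))) eq)
  ... | ()

Unit₃⇒¬3∣ : ∀ x → ¬ Unit₃ (+ 3 * x)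
Unit₃⇒¬3∣ x (unit-by v w eq) = 3*≢1 (x * v - w) (trans (expand x v w) (trans (cong (_- + 3 * w) eq) (cancel w)))
  where
  expand : ∀ x v w → + 3 * (x * v - w) ≡ + 3 * x * v - + 3 * w
  expand = solve-∀
  cancel : ∀ w → 1ℤ + + 3 * w - + 3 * w ≡ 1ℤ
  cancel = solve-∀

¬3∣⇒Unit₃ : ∀ u → ¬ 3 ∣ u → Unit₃ (+ u)
¬3∣⇒Unit₃ u 3∤u = subst Unit₃ (sym decomposition) (remainder-unit (u ℕ.% 3) refl)
  where
  decomposition : + u ≡ + (u ℕ.% 3) + + 3 * + (u ℕ./ 3)
  decomposition = trans (cong +_ (m≡m%n+[m/n]*n u 3))
    (cong (_+_ (+ (u ℕ.% 3))) (trans (ℤ.pos-* (u ℕ./ 3) 3) (ℤ.*-comm (+ (u ℕ./ 3)) (+ 3))))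
  remainder-unit : ∀ i → u ℕ.% 3 ≡ i → Unit₃ (+ i + + 3 * + (u ℕ./ 3))
  remainder-unit 0 eq = ⊥-elim (3∤u (divides (u ℕ./ 3) (trans (m≡m%n+[m/n]*n u 3) (cong (ℕ._+ u ℕ./ 3 ℕ.* 3) eq))))
  remainder-unit 1 eq = Unit₃-+3* (+ (u ℕ./ 3)) Unit₃-1
  remainder-unit 2 eq = Unit₃-+3* (+ (u ℕ./ 3)) Unit₃-2
  remainder-unit (suc (suc (suc i))) eq with subst (ℕ._< 3) eq (m%n<n u 3)
  ... | ℕ.s≤s (ℕ.s≤s (ℕ.s≤s ()))

-- A relation rather than a function: it covers negative integers, excludes zero, and supplies the
-- cofactor prime to 3.
record HasVal (e : ℕ) (z : ℤ) : Set where
  constructor hasVal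
  field
    unit-part : ℤ
    is-unit   : Unit₃ unit-part
    splitting : z ≡ (+ 3) ^ᶻ e * unit-part

HasVal-* : ∀ {e f x y} → HasVal e x → HasVal f y → HasVal (e ℕ.+ f) (x * y)
HasVal-* {e} {f} (hasVal u unit eq) (hasVal u′ unit′ eq′) = hasVal (u * u′) (Unit₃-* unit unit′)
  (trans (cong₂ _*_ eq eq′) (trans (lemma ((+ 3) ^ᶻ e) ((+ 3) ^ᶻ f) u u′) (cong (_* (u * u′)) (sym (ℤ.^-distribˡ-+-* (+ 3) e f)))))
  where
  lemma : ∀ p q u u′ → p * u * (q * u′) ≡ p * q * (u * u′)
  lemma = solve-∀

Unit₃⇒HasVal : ∀ {u} → Unit₃ u → HasVal 0 u
Unit₃⇒HasVal {u} unit = hasVal u unit (sym (ℤ.*-identityˡ u))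

HasVal-3^ : ∀ e → HasVal e ((+ 3) ^ᶻ e)
HasVal-3^ e = hasVal 1ℤ Unit₃-1 (sym (ℤ.*-identityʳ _))

3^-suc-+ : ∀ e d → (+ 3) ^ᶻ (e ℕ.+ suc d) ≡ (+ 3) ^ᶻ e * (+ 3 * (+ 3) ^ᶻ d)
3^-suc-+ e d = ℤ.^-distribˡ-+-* (+ 3) e (suc d)

<⇒∃ : ∀ {m n} → m ℕ.< n → ∃ λ d → m ℕ.+ suc d ≡ n
<⇒∃ {m} {n} m<n = n ℕ.∸ suc m , trans (ℕ.+-suc m _) (ℕ.m+[n∸m]≡n m<n)

-- A multiple of a higher power of 3 changes the unit part only by a multiple of 3.
HasVal-+ : ∀ {e f x} w → e ℕ.< f → HasVal e x → HasVal e (x + (+ 3) ^ᶻ f * w)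
HasVal-+ {e} w e<f (hasVal u unit eq) with <⇒∃ e<f
... | d , refl = hasVal (u + + 3 * ((+ 3) ^ᶻ d * w)) (Unit₃-+3* _ unit)
  (trans (cong₂ (λ x y → x + y * w) eq (3^-suc-+ e d)) (lemma ((+ 3) ^ᶻ e) ((+ 3) ^ᶻ d) u w))
  where
  lemma : ∀ p q u w → p * u + p * (+ 3 * q) * w ≡ p * (u + + 3 * (q * w))
  lemma = solve-∀

3^-nonZero : ∀ e → ℕ.NonZero ∣ (+ 3) ^ᶻ e ∣
3^-nonZero e = ℕ.≢-nonZero λ eq → zero-impossible (ℤ.i^n≡0⇒i≡0 (+ 3) e (ℤ.∣i∣≡0⇒i≡0 eq))
  where
  zero-impossible : ¬ + 3 ≡ 0ℤ
  zero-impossible ()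

3^-cancelˡ : ∀ e x y → (+ 3) ^ᶻ e * x ≡ (+ 3) ^ᶻ e * y → x ≡ y
3^-cancelˡ e x y = ℤ.*-cancelˡ-≡ ((+ 3) ^ᶻ e) x y {{3^-nonZero e}}

-- If f exceeded e, cancelling 3^e would exhibit the unit part as a multiple of 3.
HasVal-bound : ∀ {e z} f w → HasVal e z → z ≡ (+ 3) ^ᶻ f * w → f ℕ.≤ e
HasVal-bound {e} f w (hasVal u unit eq) eq′ with e ℕ.<? f
... | no  e≮f = ℕ.≮⇒≥ e≮f
... | yes e<f with <⇒∃ e<f
... | d , refl = ⊥-elim (Unit₃⇒¬3∣ ((+ 3) ^ᶻ d * w) (subst Unit₃
  (3^-cancelˡ e u (+ 3 * ((+ 3) ^ᶻ d * w))
    (trans (sym eq) (trans eq′ (trans (cong (_* w) (3^-suc-+ e d)) (lemma ((+ 3) ^ᶻ e) ((+ 3) ^ᶻ d) w))))) unit))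
  where
  lemma : ∀ p q w → p * (+ 3 * q) * w ≡ p * (+ 3 * (q * w))
  lemma = solve-∀

HasVal-unique : ∀ {e f z} → HasVal e z → HasVal f z → e ≡ f
HasVal-unique {e} {f} h@(hasVal u _ eq) h′@(hasVal u′ _ eq′) = ℕ.≤-antisym (HasVal-bound e u h′ eq) (HasVal-bound f u′ h eq′)

HasVal⇒≢0 : ∀ {e z} → HasVal e z → ¬ z ≡ 0ℤ
HasVal⇒≢0 {e} h z≡0 = ℕ.<-irrefl refl (HasVal-bound (suc e) 0ℤ h (trans z≡0 (sym (ℤ.*-zeroʳ ((+ 3) ^ᶻ suc e)))))

-- Division by 3 strictly lowers a positive argument, so fuel that bounds the argument keeps
-- bounding it.
v3-aux-HasVal : ∀ f x → 1 ℕ.≤ x → x ℕ.≤ f → HasVal (v3-aux f x) (+ x)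
v3-aux-HasVal zero    x 1≤x x≤0 = ⊥-elim (ℕ.<⇒≱ 1≤x x≤0)
v3-aux-HasVal (suc f) x 1≤x x≤f with 3 ∣? x
... | no  3∤x = Unit₃⇒HasVal (¬3∣⇒Unit₃ x 3∤x)
... | yes (divides q refl) = subst (HasVal _) (trans (ℤ.*-comm (+ 3) (+ q)) (sym (ℤ.pos-* q 3)))
  (HasVal-* (HasVal-3^ 1) (subst (λ y → HasVal (v3-aux f y) (+ q)) (sym (m*n/n≡m q 3)) (v3-aux-HasVal f q 1≤q q≤f)))
  where
  1≤q : 1 ℕ.≤ q
  1≤q = ℕ.n≢0⇒n>0 λ q≡0 → ℕ.<⇒≢ 1≤x (sym (cong (ℕ._* 3) q≡0))
  q<q*3 : q ℕ.< q ℕ.* 3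
  q<q*3 = ℕ.m<m*n q 3 {{ℕ.>-nonZero 1≤q}} (ℕ.s≤s (ℕ.s≤s ℕ.z≤n))
  q≤f : q ℕ.≤ f
  q≤f = ℕ.≤-pred (ℕ.≤-trans q<q*3 x≤f)

v3-HasVal : ∀ x → 1 ℕ.≤ x → HasVal (v3 x) (+ x)
v3-HasVal x 1≤x = v3-aux-HasVal x x 1≤x ℕ.≤-refl

-- Valuations of binomial coefficients in row a 3^r.

-- Both values are prime to 3 and less than 3; the condition on a enters the proof through these two
-- facts.
OneOrTwo : ℕ → Set
OneOrTwo a = a ≡ 1 ⊎ a ≡ 2

OneOrTwo-unit : ∀ {a} → OneOrTwo a → Unit₃ (+ a)
OneOrTwo-unit (inj₁ refl) = Unit₃-1
OneOrTwo-unit (inj₂ refl) = Unit₃-2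

OneOrTwo-<3 : ∀ {a} → OneOrTwo a → a ℕ.< 3
OneOrTwo-<3 (inj₁ refl) = ℕ.s≤s (ℕ.s≤s ℕ.z≤n)
OneOrTwo-<3 (inj₂ refl) = ℕ.≤-refl

block-ℕ : ∀ e n → block e n ≡ n ℕ.* 3 ^ e
block-ℕ zero    n = sym (ℕ.*-identityʳ n)
block-ℕ (suc e) n = trans (cong (ℕ._* 3) (block-ℕ e n)) (lemma n (3 ^ e))
  where
  lemma : ∀ n p → n ℕ.* p ℕ.* 3 ≡ n ℕ.* (3 ℕ.* p)
  lemma = ℕ-Solver.solve-∀

3^-mono : ∀ {m n} → m ℕ.≤ n → ∃ λ w → (+ 3) ^ᶻ n ≡ (+ 3) ^ᶻ m * w
3^-mono {m} {n} m≤n = (+ 3) ^ᶻ (n ℕ.∸ m) , trans (cong ((+ 3) ^ᶻ_) (sym (ℕ.m+[n∸m]≡n m≤n))) (ℤ.^-distribˡ-+-* (+ 3) m (n ℕ.∸ m))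

pos-^ : ∀ e → + (3 ^ e) ≡ (+ 3) ^ᶻ e
pos-^ zero    = refl
pos-^ (suc e) = trans (ℤ.pos-* 3 (3 ^ e)) (cong (+ 3 *_) (pos-^ e))

3^v3≤ : ∀ x → 1 ℕ.≤ x → 3 ^ v3 x ℕ.≤ x
3^v3≤ x 1≤x with v3-HasVal x 1≤x
... | hasVal u unit eq = bound ∣ u ∣ (trans (cong ∣_∣ (trans eq (cong (_* u) (sym (pos-^ (v3 x)))))) (ℤ.abs-* (+ (3 ^ v3 x)) u))
  where
  bound : ∀ n → x ≡ 3 ^ v3 x ℕ.* n → 3 ^ v3 x ℕ.≤ x
  bound zero    x≡0 = ⊥-elim (ℕ.<⇒≢ 1≤x (sym (trans x≡0 (ℕ.*-zeroʳ (3 ^ v3 x)))))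
  bound (suc n) eq  = subst (3 ^ v3 x ℕ.≤_) (sym eq) (ℕ.m≤m*n (3 ^ v3 x) (suc n))

-- A positive multiple of 3^(r+1) is larger than a 3^r, because a < 3.
v3-<block : ∀ {a} r x → OneOrTwo a → 1 ℕ.≤ x → x ℕ.< block r a → v3 x ℕ.≤ r
v3-<block {a} r x a∈ 1≤x x<T = ℕ.≮⇒≥ λ r<v → ℕ.<⇒≱ x<T (ℕ.≤-trans
  (ℕ.≤-reflexive (block-ℕ r a))
  (ℕ.≤-trans (ℕ.*-monoˡ-≤ (3 ^ r) (ℕ.<⇒≤ (OneOrTwo-<3 a∈)))
    (ℕ.≤-trans (ℕ.^-monoʳ-≤ 3 r<v) (3^v3≤ x 1≤x))))

-- From y < a 3^r follows v₃(y) ≤ r, so the power of 3 in y divides a 3^r and with it x = a 3^r - y.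
v3-complement-≤ : ∀ {a} r x y → OneOrTwo a → 1 ℕ.≤ x → 1 ℕ.≤ y → x ℕ.+ y ≡ block r a → v3 y ℕ.≤ v3 x
v3-complement-≤ {a} r x y a∈ 1≤x 1≤y x+y≡T with v3-HasVal y 1≤y
... | hasVal u unit eq with 3^-mono (v3-<block r y a∈ 1≤y (subst (y ℕ.<_) x+y≡T (ℕ.m<n+m y 1≤x)))
... | w , 3^r≡ = HasVal-bound (v3 y) (w * + a - u) (v3-HasVal x 1≤x) (begin
  + x                                     ≡⟨ add-sub (+ x) (+ y) ⟩
  (+ x + + y) - + y                       ≡⟨ cong₂ _-_ (trans (cong +_ x+y≡T) (trans (block-pos r a) (cong (_* + a) 3^r≡))) eq ⟩
  (+ 3) ^ᶻ v3 y * w * + a - (+ 3) ^ᶻ v3 y * u  ≡⟨ lemma ((+ 3) ^ᶻ v3 y) w (+ a) u ⟩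
  (+ 3) ^ᶻ v3 y * (w * + a - u)            ∎)
  where
  open ≡-Reasoning
  add-sub : ∀ x y → x ≡ (x + y) - y
  add-sub = solve-∀
  lemma : ∀ p w a u → p * w * a - p * u ≡ p * (w * a - u)
  lemma = solve-∀

v3-complement : ∀ {a} r x y → OneOrTwo a → 1 ℕ.≤ x → 1 ℕ.≤ y → x ℕ.+ y ≡ block r a → v3 x ≡ v3 y
v3-complement r x y a∈ 1≤x 1≤y x+y≡T = ℕ.≤-antisym
  (v3-complement-≤ r y x a∈ 1≤y 1≤x (trans (ℕ.+-comm y x) x+y≡T))
  (v3-complement-≤ r x y a∈ 1≤x 1≤y x+y≡T)

C-absorption : ∀ n k → suc k ℕ.* (suc n C suc k) ≡ suc n ℕ.* (n C k)
C-absorption n k = begin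
  suc k ℕ.* (suc n C suc k)                  ≡⟨ cong (suc k ℕ.*_) (nCk+nC[k+1]≡[n+1]C[k+1] n k) ⟨
  suc k ℕ.* (n C k ℕ.+ n C suc k)            ≡⟨ ℕ.*-distribˡ-+ (suc k) (n C k) (n C suc k) ⟩
  suc k ℕ.* (n C k) ℕ.+ suc k ℕ.* (n C suc k) ≡⟨ step n k ⟩
  suc n ℕ.* (n C k)                          ∎
  where
  open ≡-Reasoning
  expand₀ : ∀ n → 1 ℕ.* 1 ℕ.+ suc n ℕ.* 1 ≡ suc (suc n) ℕ.* 1
  expand₀ = ℕ-Solver.solve-∀
  step : ∀ n k → suc k ℕ.* (n C k) ℕ.+ suc k ℕ.* (n C suc k) ≡ suc n ℕ.* (n C k)
  step zero zero    = refl
  step zero (suc k) rewrite k>n⇒nCk≡0 {0} {suc k} (ℕ.s≤s ℕ.z≤n) | k>n⇒nCk≡0 {0} {suc (suc k)} (ℕ.s≤s ℕ.z≤n)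
    | ℕ.*-zeroʳ k = refl
  step (suc n) zero = trans (cong (λ z → 1 ℕ.* 1 ℕ.+ z) (C-absorption n 0)) (expand₀ n)
  step (suc n) (suc k) = begin
    suc (suc k) ℕ.* (suc n C suc k) ℕ.+ suc (suc k) ℕ.* (suc n C suc (suc k))
      ≡⟨ cong₂ (λ x y → suc n C suc k ℕ.+ x ℕ.+ y) (C-absorption n k) (C-absorption n (suc k)) ⟩
    suc n C suc k ℕ.+ suc n ℕ.* (n C k) ℕ.+ suc n ℕ.* (n C suc k)
      ≡⟨ ℕ.+-assoc (suc n C suc k) _ _ ⟩
    suc n C suc k ℕ.+ (suc n ℕ.* (n C k) ℕ.+ suc n ℕ.* (n C suc k))
      ≡⟨ cong (suc n C suc k ℕ.+_) (ℕ.*-distribˡ-+ (suc n) (n C k) (n C suc k)) ⟨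
    suc n C suc k ℕ.+ suc n ℕ.* (n C k ℕ.+ n C suc k)
      ≡⟨ cong (λ z → suc n C suc k ℕ.+ suc n ℕ.* z) (nCk+nC[k+1]≡[n+1]C[k+1] n k) ⟩
    suc (suc n) ℕ.* (suc n C suc k) ∎

C-shift : ∀ n k y → suc k ℕ.+ y ≡ suc n → suc k ℕ.* (n C suc k) ≡ y ℕ.* (n C k)
C-shift n k y k+y≡n = ℕ.+-cancelˡ-≡ (suc k ℕ.* (n C k)) _ _ (begin
  suc k ℕ.* (n C k) ℕ.+ suc k ℕ.* (n C suc k)  ≡⟨ ℕ.*-distribˡ-+ (suc k) (n C k) (n C suc k) ⟨
  suc k ℕ.* (n C k ℕ.+ n C suc k)              ≡⟨ cong (suc k ℕ.*_) (nCk+nC[k+1]≡[n+1]C[k+1] n k) ⟩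
  suc k ℕ.* (suc n C suc k)                    ≡⟨ C-absorption n k ⟩
  suc n ℕ.* (n C k)                            ≡⟨ cong (ℕ._* (n C k)) k+y≡n ⟨
  (suc k ℕ.+ y) ℕ.* (n C k)                    ≡⟨ ℕ.*-distribʳ-+ (n C k) (suc k) y ⟩
  suc k ℕ.* (n C k) ℕ.+ y ℕ.* (n C k)          ∎)
  where open ≡-Reasoning

-- C(n, j+1) / C(n, j) = (n - j) / (j + 1), where numerator and denominator add up to n + 1 = a 3^r
-- and therefore have the same valuation.
C-unit : ∀ {a} r n j → OneOrTwo a → suc n ≡ block r a → j ℕ.≤ n → Unit₃ (+ (n C j))
C-unit r n zero    a∈ n≡ j≤n = Unit₃-1
C-unit r n (suc j) a∈ n≡ j<n with v3-HasVal (suc j) (ℕ.s≤s ℕ.z≤n) | v3-HasVal (n ℕ.∸ j) (ℕ.m<n⇒0<n∸m j<n)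
... | hasVal u unit eq | hasVal u′ unit′ eq′ = Unit₃-factorʳ u (+ (n C suc j)) (subst Unit₃ (sym ratio)
  (Unit₃-* unit′ (C-unit r n j a∈ n≡ (ℕ.<⇒≤ j<n))))
  where
  y = n ℕ.∸ j
  v = v3 (suc j)
  open ≡-Reasoning
  j+y≡n : suc j ℕ.+ y ≡ suc n
  j+y≡n = cong suc (ℕ.m+[n∸m]≡n (ℕ.<⇒≤ j<n))
  same : v3 y ≡ v
  same = sym (v3-complement r (suc j) y a∈ (ℕ.s≤s ℕ.z≤n) (ℕ.m<n⇒0<n∸m j<n) (trans j+y≡n n≡))
  ratio : u * + (n C suc j) ≡ u′ * + (n C j)
  ratio = 3^-cancelˡ v _ _ (begin
    (+ 3) ^ᶻ v * (u * + (n C suc j))    ≡⟨ ℤ.*-assoc ((+ 3) ^ᶻ v) u _ ⟨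
    (+ 3) ^ᶻ v * u * + (n C suc j)      ≡⟨ cong (_* + (n C suc j)) eq ⟨
    + suc j * + (n C suc j)            ≡⟨ ℤ.pos-* (suc j) (n C suc j) ⟨
    + (suc j ℕ.* (n C suc j))          ≡⟨ cong +_ (C-shift n j y j+y≡n) ⟩
    + (y ℕ.* (n C j))                  ≡⟨ ℤ.pos-* y (n C j) ⟩
    + y * + (n C j)                    ≡⟨ cong (_* + (n C j)) (trans eq′ (cong (λ i → (+ 3) ^ᶻ i * u′) same)) ⟩
    (+ 3) ^ᶻ v * u′ * + (n C j)         ≡⟨ ℤ.*-assoc ((+ 3) ^ᶻ v) u′ _ ⟩
    (+ 3) ^ᶻ v * (u′ * + (n C j))       ∎)

-- t C(T, s) = t C(T, t) = T C(T - 1, t - 1) with T = a 3^r, and the last binomial coefficient is a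
-- unit.
C-valuation : ∀ {a} r s t → OneOrTwo a → 1 ℕ.≤ t → s ℕ.+ t ≡ block r a → HasVal r (+ t * + (block r a C s))
C-valuation {a} r s (suc t) a∈ 1≤t s+t≡T = hasVal (+ a * + (n C t))
  (Unit₃-* (OneOrTwo-unit a∈) (C-unit r n t a∈ n≡T (ℕ.m≤n+m t s))) (begin
  + suc t * + (block r a C s)       ≡⟨ ℤ.pos-* (suc t) _ ⟨
  + (suc t ℕ.* (block r a C s))     ≡⟨ cong (λ N → + (suc t ℕ.* (N C s))) (sym n≡T) ⟩
  + (suc t ℕ.* (suc n C s))         ≡⟨ cong (λ c → + (suc t ℕ.* c)) complement ⟩
  + (suc t ℕ.* (suc n C suc t))     ≡⟨ cong +_ (C-absorption n t) ⟩
  + (suc n ℕ.* (n C t))             ≡⟨ ℤ.pos-* (suc n) (n C t) ⟩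
  + suc n * + (n C t)               ≡⟨ cong (_* + (n C t)) (trans (cong +_ n≡T) (block-pos r a)) ⟩
  (+ 3) ^ᶻ r * + a * + (n C t)       ≡⟨ ℤ.*-assoc ((+ 3) ^ᶻ r) (+ a) _ ⟩
  (+ 3) ^ᶻ r * (+ a * + (n C t))     ∎)
  where
  open ≡-Reasoning
  n = s ℕ.+ t
  n≡T : suc n ≡ block r a
  n≡T = trans (sym (ℕ.+-suc s t)) s+t≡T
  s≤n : s ℕ.≤ suc n
  s≤n = ℕ.m≤n⇒m≤1+n (ℕ.m≤m+n s t)
  complement : suc n C s ≡ suc n C suc t
  complement = trans (nCk≡nC[n∸k] s≤n)
    (cong (suc n C_) (trans (cong (ℕ._∸ s) (sym (ℕ.+-suc s t))) (ℕ.m+n∸m≡n s (suc t))))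

-- Valuations of the coefficients of `σ`.

-- The congruence holds modulo 3^(r+1), one power beyond the valuation r of t C(T, s), so its error
-- term cannot disturb the result.
σ-even-valuation : ∀ {a} e r s t → OneOrTwo a → 1 ℕ.≤ t → s ℕ.+ t ≡ block r a →
  HasVal r (+ t * σ e r a (block r a ℕ.+ s ℕ.* 2))
σ-even-valuation {a} e r s t a∈ 1≤t s+t≡T with σ-even e r a s
... | j , w , eq = subst (HasVal r)
  (sym (trans (cong (+ t *_) eq) (lemma (+ t) ((+ 2) ^ᶻ j) (+ (block r a C s)) ((+ 3) ^ᶻ suc r) w)))
  (HasVal-+ (+ t * w) ℕ.≤-refl (HasVal-* (Unit₃⇒HasVal (Unit₃-2^ j)) (C-valuation r s t a∈ 1≤t s+t≡T)))
  where
  lemma : ∀ t p c q w → t * (p * c + q * w) ≡ p * (t * c) + q * (t * w)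
  lemma = solve-∀

thirds : ∀ r a s t → s ℕ.+ t ≡ block r a → (block r a ℕ.+ s ℕ.* 2) ℕ.+ t ℕ.* 2 ≡ block (suc r) a
thirds r a s t eq = subst (λ T → (T ℕ.+ s ℕ.* 2) ℕ.+ t ℕ.* 2 ≡ T ℕ.* 3) eq (lemma s t)
  where
  lemma : ∀ s t → (s ℕ.+ t ℕ.+ s ℕ.* 2) ℕ.+ t ℕ.* 2 ≡ (s ℕ.+ t) ℕ.* 3
  lemma = ℕ-Solver.solve-∀

-- All terms after the first acquire q³: m² s₂ through its three factors q, and m³ by itself.
clear-recurrence : ∀ t q a k k₁ k₂ w x {m s₀ s₁ s₂} → m ≡ q * a → s₂ ≡ q * w →
  + 4 * s₀ ≡ + 2 * (m * k * s₁) - m * m * (k₁ * (k₂ * s₂)) + m * m * m * x →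
  + 4 * t * s₀ ≡ + 2 * a * q * k * (t * s₁) + q * q * q * (t * (a * a * a * x - a * a * (k₁ * (k₂ * w))))
clear-recurrence t q a k k₁ k₂ w x {s₀ = s₀} {s₁} refl refl recurrence = begin
  + 4 * t * s₀
    ≡⟨ commute t s₀ ⟩
  t * (+ 4 * s₀)
    ≡⟨ cong (t *_) recurrence ⟩
  t * (+ 2 * (q * a * k * s₁) - (q * a) * (q * a) * (k₁ * (k₂ * (q * w))) + (q * a) * (q * a) * (q * a) * x)
    ≡⟨ cong₂ (λ y z → t * (+ 2 * y - (q * a) * (q * a) * z + (q * a) * (q * a) * (q * a) * x))
         (ℤ.*-assoc (q * a) k s₁) (pull-out k₁ k₂ q w) ⟩
  t * (+ 2 * (q * a * (k * s₁)) - (q * a) * (q * a) * (q * (k₁ * (k₂ * w))) + (q * a) * (q * a) * (q * a) * x)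
    ≡⟨ expand t q a (k * s₁) (k₁ * (k₂ * w)) x ⟩
  + 2 * a * q * (t * (k * s₁)) + q * q * q * (t * (a * a * a * x - a * a * (k₁ * (k₂ * w))))
    ≡⟨ cong (_+ q * q * q * (t * (a * a * a * x - a * a * (k₁ * (k₂ * w))))) (regroup (+ 2 * a * q) t k s₁) ⟩
  + 2 * a * q * k * (t * s₁) + q * q * q * (t * (a * a * a * x - a * a * (k₁ * (k₂ * w)))) ∎
  where
  open ≡-Reasoning
  expand : ∀ t q a c g x →
    t * (+ 2 * (q * a * c) - (q * a) * (q * a) * (q * g) + (q * a) * (q * a) * (q * a) * x) ≡
    + 2 * a * q * (t * c) + q * q * q * (t * (a * a * a * x - a * a * g))
  expand = solve-∀
  pull-out : ∀ k₁ k₂ q w → k₁ * (k₂ * (q * w)) ≡ q * (k₁ * (k₂ * w))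
  pull-out = solve-∀
  regroup : ∀ b t k y → b * (t * (k * y)) ≡ b * k * (t * y)
  regroup = solve-∀
  commute : ∀ t y → + 4 * t * y ≡ t * (+ 4 * y)
  commute = solve-∀

-- The first term has valuation R + v + r, which v ≤ R and r < R keep below the 3R of the rest.
HasVal-leading-term : ∀ {R v r a k y z} rest → Unit₃ a → HasVal v k → HasVal r y → v ℕ.≤ R → r ℕ.< R →
  z ≡ + 2 * a * (+ 3) ^ᶻ R * k * y + (+ 3) ^ᶻ R * (+ 3) ^ᶻ R * (+ 3) ^ᶻ R * rest → HasVal (R ℕ.+ v ℕ.+ r) z
HasVal-leading-term {R} {v} {r} {a} {k} {y} rest a-unit k-val y-val v≤R r<R refl =
  subst (λ q → HasVal (R ℕ.+ v ℕ.+ r) (+ 2 * a * (+ 3) ^ᶻ R * k * y + q * rest)) cube-3^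
    (HasVal-+ rest (ℕ.+-mono-≤-< (ℕ.+-monoʳ-≤ R v≤R) r<R)
      (HasVal-* (HasVal-* (HasVal-* (Unit₃⇒HasVal (Unit₃-* Unit₃-2 a-unit)) (HasVal-3^ R)) k-val) y-val))
  where
  cube-3^ : (+ 3) ^ᶻ (R ℕ.+ R ℕ.+ R) ≡ (+ 3) ^ᶻ R * (+ 3) ^ᶻ R * (+ 3) ^ᶻ R
  cube-3^ = trans (ℤ.^-distribˡ-+-* (+ 3) (R ℕ.+ R) R) (cong (_* (+ 3) ^ᶻ R) (ℤ.^-distribˡ-+-* (+ 3) R R))

-- Here `k` is the coefficient index K = M - (2t + 1), and K + 1 = T + 2s falls under the even case.
-- For s = 0 the index is T - 1, just below the support of (y (y² + 2))^T.
σ-odd-valuation : ∀ {a} e r s t k → OneOrTwo a → 1 ℕ.≤ t → s ℕ.+ t ≡ block r a → 1 ℕ.≤ k → suc k ≡ block r a ℕ.+ s ℕ.* 2 →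
  HasVal (suc r ℕ.+ v3 k ℕ.+ r) (+ 4 * + t * σ e r a k)
σ-odd-valuation {a} e r s t k a∈ 1≤t s+t≡T 1≤k k≡ =
  let x , recurrence = odd-recurrence e (block (suc r) a) k t k+odd≡M
      w , σ-odd≡ = σ-odd e r a s
      σ-k+2 = trans (cong (σ e r a) (trans (cong suc k≡) (sym (ℕ.+-suc (block r a) (s ℕ.* 2))))) σ-odd≡
  in HasVal-leading-term _ (OneOrTwo-unit a∈) (v3-HasVal k 1≤k)
       (subst (λ i → HasVal r (+ t * σ e r a i)) (sym k≡) (σ-even-valuation e r s t a∈ 1≤t s+t≡T))
       (v3-<block (suc r) k a∈ 1≤k k<M) (ℕ.n<1+n r)
       (clear-recurrence (+ t) ((+ 3) ^ᶻ suc r) (+ a) (+ k) (+ suc k) (+ suc (suc k)) w x (block-pos (suc r) a) σ-k+2 recurrence)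
  where
  k+odd≡M : k ℕ.+ (1 ℕ.+ t ℕ.* 2) ≡ block (suc r) a
  k+odd≡M = trans (ℕ.+-suc k (t ℕ.* 2)) (trans (cong (ℕ._+ t ℕ.* 2) k≡) (thirds r a s t s+t≡T))
  k<M : k ℕ.< block (suc r) a
  k<M = subst (suc k ℕ.≤_) (trans (cong (ℕ._+ t ℕ.* 2) k≡) (thirds r a s t s+t≡T)) (ℕ.m≤m+n (suc k) (t ℕ.* 2))

-- Return to Stirling numbers and to the stated formula.

-- `x` stands for the multiplier t or 4t under which the coefficient's valuation is known. Its own
-- valuation stays on the left, so the identity needs no subtraction.
stirling1-valuation : ∀ e n k {x v q} → HasVal v x → HasVal q (x * P e n 0ℤ k) →
  v ℕ.+ (e ℕ.* k ℕ.+ v3 (stirling1 (block e n) k)) ≡ content-exponent e n ℕ.+ q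
stirling1-valuation e n k {x} x-val product-val = HasVal-unique
  (HasVal-* x-val (HasVal-* (HasVal-3^ (e ℕ.* k)) (v3-HasVal S S≥1))) scaled
  where
  S = stirling1 (block e n) k
  exchange : ∀ p x y → p * (x * y) ≡ x * (p * y)
  exchange = solve-∀
  scaled : HasVal _ (x * ((+ 3) ^ᶻ (e ℕ.* k) * + S))
  scaled = subst (HasVal _) (trans (exchange ((+ 3) ^ᶻ content-exponent e n) x (P e n 0ℤ k))
    (cong (x *_) (trans (σ-stirling1 e n k) (cong (_* + S) (ℤ.^-*-assoc (+ 3) e k)))))
    (HasVal-* (HasVal-3^ (content-exponent e n)) product-val)
  -- `v3-HasVal` asks for a positive argument; if the Stirling number were 0, `scaled` would assign
  -- a valuation to 0.
  S≥1 : 1 ℕ.≤ S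
  S≥1 = ℕ.n≢0⇒n>0 λ S≡0 → HasVal⇒≢0 scaled (trans
    (cong (λ z → x * ((+ 3) ^ᶻ (e ℕ.* k) * + z)) S≡0)
    (trans (cong (x *_) (ℤ.*-zeroʳ ((+ 3) ^ᶻ (e ℕ.* k)))) (ℤ.*-zeroʳ x)))

-- The exponent is n (3^e - 1) / 2; for n = a 3^m it becomes the term a (3^(m+e) - 3^m) / 2 of the
-- formula.
content-exponent-twice : ∀ e n → content-exponent e n ℕ.* 2 ℕ.+ n ≡ block e n
content-exponent-twice zero    n = refl
content-exponent-twice (suc e) n = trans (regroup (block e n) (content-exponent e n) n)
  (trans (cong (block e n ℕ.* 2 ℕ.+_) (content-exponent-twice e n)) (sum (block e n)))
  where
  regroup : ∀ b x n → (b ℕ.+ x) ℕ.* 2 ℕ.+ n ≡ b ℕ.* 2 ℕ.+ (x ℕ.* 2 ℕ.+ n)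
  regroup = ℕ-Solver.solve-∀
  sum : ∀ b → b ℕ.* 2 ℕ.+ b ≡ b ℕ.* 3
  sum = ℕ-Solver.solve-∀

block-powers : ∀ a {n m} → m ℕ.≤ n → block (n ℕ.∸ m) (block m a) ≡ a ℕ.* 3 ^ n
block-powers a {n} {m} m≤n = begin
  block (n ℕ.∸ m) (block m a)               ≡⟨ block-ℕ (n ℕ.∸ m) (block m a) ⟩
  block m a ℕ.* 3 ^ (n ℕ.∸ m)             ≡⟨ cong (ℕ._* 3 ^ (n ℕ.∸ m)) (block-ℕ m a) ⟩
  a ℕ.* 3 ^ m ℕ.* 3 ^ (n ℕ.∸ m)         ≡⟨ ℕ.*-assoc a (3 ^ m) _ ⟩
  a ℕ.* (3 ^ m ℕ.* 3 ^ (n ℕ.∸ m))       ≡⟨ cong (a ℕ.*_) (ℕ.^-distribˡ-+-* 3 m (n ℕ.∸ m)) ⟨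
  a ℕ.* 3 ^ (m ℕ.+ (n ℕ.∸ m))             ≡⟨ cong (λ i → a ℕ.* 3 ^ i) (ℕ.m+[n∸m]≡n m≤n) ⟩
  a ℕ.* 3 ^ n                             ∎
  where open ≡-Reasoning

content-exponent-half : ∀ a {n m} → m ℕ.≤ n → (a ℕ.* (3 ^ n ℕ.∸ 3 ^ m)) ℕ./ 2 ≡ content-exponent (n ℕ.∸ m) (block m a)
content-exponent-half a {n} {m} m≤n = trans (cong (ℕ._/ 2) (begin
  a ℕ.* (3 ^ n ℕ.∸ 3 ^ m)            ≡⟨ ℕ.*-distribˡ-∸ a (3 ^ n) (3 ^ m) ⟩
  a ℕ.* 3 ^ n ℕ.∸ a ℕ.* 3 ^ m        ≡⟨ cong₂ ℕ._∸_ (trans (sym (block-powers a m≤n)) (sym (content-exponent-twice e M))) (sym (block-ℕ m a)) ⟩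
  (content-exponent e M ℕ.* 2 ℕ.+ M) ℕ.∸ M          ≡⟨ ℕ.m+n∸n≡m (content-exponent e M ℕ.* 2) M ⟩
  content-exponent e M ℕ.* 2                        ∎)) (m*n/n≡m (content-exponent e M) 2)
  where
  open ≡-Reasoning
  e = n ℕ.∸ m
  M = block m a

solve-for-valuation : ∀ v e K S A r c {z} → v ℕ.+ (e ℕ.* K ℕ.+ S) ≡ A ℕ.+ (r ℕ.+ c) → z ≡ + c →
  + S ≡ + A - + e * + K + + suc r - + 1 - + v + z
solve-for-valuation v e K S A r c eq refl = begin
  + S                                               ≡⟨ isolate (+ v) (+ (e ℕ.* K)) (+ S) ⟩
  (+ v + (+ (e ℕ.* K) + + S)) - + (e ℕ.* K) - + v   ≡⟨ cong₂ (λ x y → x - y - + v) (cong +_ eq) (ℤ.pos-* e K) ⟩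
  (+ A + (+ r + + c)) - + e * + K - + v             ≡⟨ collect (+ A) (+ r) (+ c) (+ e * + K) (+ v) ⟩
  + A - + e * + K + + suc r - + 1 - + v + + c       ∎
  where
  open ≡-Reasoning
  isolate : ∀ v x s → s ≡ (v + (x + s)) - x - v
  isolate = solve-∀
  collect : ∀ A r c x v → (A + (r + c)) - x - v ≡ A - x + (1ℤ + r) - 1ℤ - v + c
  collect = solve-∀

data Half : ℕ → Set where
  even : ∀ t → Half (t ℕ.* 2)
  odd  : ∀ t → Half (1 ℕ.+ t ℕ.* 2)

half : ∀ k → Half k
half zero = even 0
half (suc k) with half k
... | even t = odd t
... | odd t  = even (suc t)

odd/2 : ∀ t → (1 ℕ.+ t ℕ.* 2) ℕ./ 2 ≡ t
odd/2 t = trans (+-distrib-/-∣ʳ 1 {t ℕ.* 2} {2} (divides t refl)) (m*n/n≡m t 2)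

double-≤ : ∀ {t} n → t ℕ.* 2 ≤ n ℕ.* 2 ℕ.+ 1 → t ≤ n
double-≤ {t} n 2t≤2n+1 = ℕ.≮⇒≥ λ n<t → ℕ.<⇒≱ (ℕ.≤-trans (ℕ.≤-reflexive (odd-suc n)) (ℕ.*-monoˡ-≤ 2 n<t)) 2t≤2n+1
  where
  odd-suc : ∀ n → suc (n ℕ.* 2 ℕ.+ 1) ≡ suc n ℕ.* 2
  odd-suc = ℕ-Solver.solve-∀

valuation-even : ∀ {a} e r t → OneOrTwo a → 1 ≤ t → t ≤ block r a → let M = block (suc r) a in
  v3 t ℕ.+ (e ℕ.* (M ∸ t ℕ.* 2) ℕ.+ v3 (stirling1 (block e M) (M ∸ t ℕ.* 2))) ≡ content-exponent e M ℕ.+ r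
valuation-even {a} e r t a∈ 1≤t t≤T = stirling1-valuation e M (M ∸ t ℕ.* 2) (v3-HasVal t 1≤t)
  (subst (λ K → HasVal r (+ t * σ e r a K)) index (σ-even-valuation e r s t a∈ 1≤t s+t≡T))
  where
  T = block r a
  M = block (suc r) a
  s = T ∸ t
  s+t≡T : s ℕ.+ t ≡ T
  s+t≡T = ℕ.m∸n+n≡m t≤T
  index : T ℕ.+ s ℕ.* 2 ≡ M ∸ t ℕ.* 2
  index = trans (sym (ℕ.m+n∸n≡m (T ℕ.+ s ℕ.* 2) (t ℕ.* 2))) (cong (_∸ t ℕ.* 2) (thirds r a s t s+t≡T))

valuation-odd : ∀ {a} e r t → OneOrTwo a → 1 ≤ t → t ≤ block r a → let M = block (suc r) a ; k = 1 ℕ.+ t ℕ.* 2 in k < M →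
  v3 t ℕ.+ (e ℕ.* (M ∸ k) ℕ.+ v3 (stirling1 (block e M) (M ∸ k))) ≡ content-exponent e M ℕ.+ (r ℕ.+ (suc r ℕ.+ v3 k))
valuation-odd {a} e r t a∈ 1≤t t≤T k<M = trans
  (stirling1-valuation e M K (HasVal-* (Unit₃⇒HasVal (Unit₃-* Unit₃-2 Unit₃-2)) (v3-HasVal t 1≤t))
    (σ-odd-valuation e r s t K a∈ 1≤t s+t≡T 1≤K index))
  (cong (content-exponent e M ℕ.+_) (trans (ℕ.+-comm (suc r ℕ.+ v3 K) r) (cong (λ v → r ℕ.+ (suc r ℕ.+ v)) v3-K)))
  where
  T = block r a
  M = block (suc r) a
  k = 1 ℕ.+ t ℕ.* 2
  K = M ∸ k
  s = T ∸ t
  s+t≡T : s ℕ.+ t ≡ T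
  s+t≡T = ℕ.m∸n+n≡m t≤T
  1≤K : 1 ≤ K
  1≤K = ℕ.m<n⇒0<n∸m k<M
  K+k≡M : K ℕ.+ k ≡ M
  K+k≡M = ℕ.m∸n+n≡m (ℕ.<⇒≤ k<M)
  index : suc K ≡ T ℕ.+ s ℕ.* 2
  index = ℕ.+-cancelʳ-≡ (t ℕ.* 2) _ _ (trans (sym (ℕ.+-suc K (t ℕ.* 2))) (trans K+k≡M (sym (thirds r a s t s+t≡T))))
  -- The recurrence produces v₃(K), the formula asks for v₃(k); the two numbers add up to a 3^m.
  v3-K : v3 K ≡ v3 k
  v3-K = v3-complement (suc r) K k a∈ 1≤K (ℕ.s≤s ℕ.z≤n) K+k≡M

valuation : ∀ {a} e r k → OneOrTwo a → 2 ≤ k → k ≤ block r a ℕ.* 2 ℕ.+ 1 → let M = block (suc r) a in k < M →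
  v3 (k / 2) ℕ.+ (e ℕ.* (M ∸ k) ℕ.+ v3 (stirling1 (block e M) (M ∸ k))) ≡ content-exponent e M ℕ.+ (r ℕ.+ (suc r ℕ.+ v3 k) ℕ.* ε k)
valuation {a} e r k a∈ 2≤k k≤ k<M with half k
... | even t = trans (cong (λ x → v3 x ℕ.+ rest) (m*n/n≡m t 2))
  (trans (valuation-even e r t a∈ (positive t 2≤k) (double-≤ (block r a) k≤))
    (cong (content-exponent e M ℕ.+_) (sym (trans (cong (λ x → r ℕ.+ (suc r ℕ.+ v3 (t ℕ.* 2)) ℕ.* x) (m*n%n≡0 t 2))
      (trans (cong (r ℕ.+_) (ℕ.*-zeroʳ (suc r ℕ.+ v3 (t ℕ.* 2)))) (ℕ.+-identityʳ r))))))
  where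
  M = block (suc r) a
  rest = e ℕ.* (M ∸ t ℕ.* 2) ℕ.+ v3 (stirling1 (block e M) (M ∸ t ℕ.* 2))
  positive : ∀ t → 2 ≤ t ℕ.* 2 → 1 ≤ t
  positive (suc t) _ = ℕ.s≤s ℕ.z≤n
... | odd t = trans (cong (λ x → v3 x ℕ.+ rest) (odd/2 t))
  (trans (valuation-odd e r t a∈ (positive t 2≤k) (double-≤ (block r a) (ℕ.<⇒≤ k≤)) k<M)
    (cong (λ x → content-exponent e M ℕ.+ (r ℕ.+ x)) (sym (trans (cong ((suc r ℕ.+ v3 (1 ℕ.+ t ℕ.* 2)) ℕ.*_) ([m+kn]%n≡m%n 1 t 2))
      (ℕ.*-identityʳ _)))))
  where
  M = block (suc r) a
  rest = e ℕ.* (M ∸ (1 ℕ.+ t ℕ.* 2)) ℕ.+ v3 (stirling1 (block e M) (M ∸ (1 ℕ.+ t ℕ.* 2)))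
  positive : ∀ t → 2 ≤ 1 ℕ.+ t ℕ.* 2 → 1 ≤ t
  positive zero    (ℕ.s≤s ())
  positive (suc t) _ = ℕ.s≤s ℕ.z≤n

theorem1p1 : (a n m k : ℕ) → (a ≡ 1 ⊎ a ≡ 2) → 1 ≤ m → m ≤ n →
    2 ≤ k → k Data.Nat.≤ 2 Data.Nat.* a Data.Nat.* 3 ^ (m ∸ 1) Data.Nat.+ 1 → k < a Data.Nat.* 3 ^ m →
    + v3 (stirling1 (a Data.Nat.* 3 ^ n) (a Data.Nat.* 3 ^ m ∸ k))
    ≡ + ((a Data.Nat.* (3 ^ n ∸ 3 ^ m)) / 2)
    - (+ (n ∸ m)) * (+ (a Data.Nat.* 3 ^ m ∸ k))
    + + m - + 1 - + v3 (k / 2)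
    + (+ m + + v3 k) * + ε k
theorem1p1 a n (suc r) k a∈ _ m≤n 2≤k k≤ k<M =
  solve-for-valuation (v3 (k / 2)) e (a ℕ.* 3 ^ suc r ∸ k) _ _ r ((suc r ℕ.+ v3 k) ℕ.* ε k)
    (trans (cong₂ (λ N M → v3 (k / 2) ℕ.+ (e ℕ.* (M ∸ k) ℕ.+ v3 (stirling1 N (M ∸ k))))
             (sym (block-powers a m≤n)) (sym (block-ℕ (suc r) a)))
      (trans (valuation e r k a∈ 2≤k (ℕ.≤-trans k≤ (ℕ.≤-reflexive bound)) (subst (k <_) (sym (block-ℕ (suc r) a)) k<M))
        (cong (ℕ._+ (r ℕ.+ (suc r ℕ.+ v3 k) ℕ.* ε k)) (sym (content-exponent-half a m≤n)))))
    (sym (ℤ.pos-* (suc r ℕ.+ v3 k) (ε k)))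
  where
  e = n ∸ suc r
  bound : 2 ℕ.* a ℕ.* 3 ^ r ℕ.+ 1 ≡ block r a ℕ.* 2 ℕ.+ 1
  bound = cong (ℕ._+ 1) (trans (ℕ.*-assoc 2 a (3 ^ r)) (trans (ℕ.*-comm 2 (a ℕ.* 3 ^ r)) (cong (ℕ._* 2) (sym (block-ℕ r a)))))
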